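{- Let $\mathcal{GA}_n$ be the set of nonsingular $2^n\times2^n$ signature matrices of affine functions of arity $2n$, and let $\mathcal{UA}_n$ be the set of unitary $2^n\times2^n$ signature matrices of affine functions of arity $2n$. Then $$\mathcal{GA}_n/U(1)=\mathcal{UA}_n/U(1).$$
   Context: Affine functions. A function $f:\{0,1\}^k\to\mathbb{C}$ is affine if there are $\lambda\in\mathbb{C}$, a matrix $A$ over $\mathbb{F}_2$ with $k+1$ columns, and finitely many vectors $\boldsymbol{\alpha}_1,\dots,\boldsymbol{\alpha}_m\in\mathbb{F}_2^{k+1}$ such that, with $\mathbf{x}=(x_1,\dots,x_k,1)^{\mathsf T}$, $$f(x_1,\dots,x_k)=\lambda\,\chi_{A\mathbf{x}=0}\cdot i^{\sum_{j=1}^m\langle\boldsymbol{\alpha}_j,\mathbf{x}\rangle},\qquad i=\sqrt{ -1}.$$ Here $\chi_{A\mathbf{x}=0}$ is $1$ if $A\mathbf{x}=0$ over $\mathbb{F}_2$ and $0$ otherwise; each $\langle\boldsymbol{\alpha}_j,\mathbf{x}\rangle$ is computed in $\mathbb{F}_2$ and then regarded as the integer $0$ or $1$, and the outer sum is a sum mod 4 of these 0-1 terms. The set of all affine functions (of all arities) is $\mathscr{A}$. Signature matrix. For $f:\{0,1\}^{2n}\to\mathbb{C}$, $M_f$ is the $2^n\times2^n$ matrix with rows and columns indexed by $\{0,1\}^n$ whose entry in row $(x_1,\dots,x_n)$ and column $(x_{2n},x_{2n-1},\dots,x_{n+1})$ is $f(x_1,\dots,x_{2n})$. Set $\mathcal{A}_n=\{M_f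 : f\in\mathscr{A},\ f \text{ of arity } 2n\}$, $\mathcal{GA}_n=GL_{2^n}(\mathbb{C})\cap\mathcal{A}_n$ and $\mathcal{UA}_n=U(2^n)\cap\mathcal{A}_n$, where $GL_k(\mathbb{C})$ is the group of nonsingular $k\times k$ complex matrices and $U(k)$ is the group of $k\times k$ unitary matrices. $U(1)=\{z\in\mathbb{C} : |z|=1\}$ is identified with the scalar matrices $zI_{2^n}$, $|z|=1$; the quotient $/U(1)$ means that matrices differing by a scalar factor of norm one are identified.
   Formalization: As printed the claim fails (2I is a nonsingular affine signature matrix but not a norm-one multiple of a unitary one); the nonsingular side is instead taken modulo all nonzero complex scalars: GA_n/C^× = UA_n/U(1), with the classes of UA_n mod U(1) kept distinct. -}

module Defs where

open import Data.Bool using (Bool; true; false; _∧_; _xor_; if_then_else_)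
import Data.Bool.Properties as Bool
open import Data.Nat as ℕ using (ℕ; zero; suc; _⊔_)
import Data.Nat.Properties as ℕ
open import Data.Product using (Σ-syntax; ∃-syntax; _×_; _,_)
open import Data.Rational as ℚ using (ℚ; 0ℚ; 1ℚ; ∣_∣; NonZero; Positive; positive; 1/_)
import Data.Rational.Properties as ℚ
open import Data.Rational.Solver using (module +-*-Solver)
open import Data.Vec using (Vec; []; _∷_; _∷ʳ_; _++_; foldr′; map; replicate; reverse; sum; zipWith)
open import Data.Vec.Properties using (≡-dec)
open import Function.Bundles using (_⇔_)
open import Relation.Binary.PropositionalEquality using (_≡_; refl; sym; trans; cong; cong₂; subst)
open import Relation.Nullary using (does)

-- Reals are Cauchy sequences of rationals; their equality is _≈ʳ_, not _≡_.
Cauchy : (ℕ → ℚ) → Set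
Cauchy s = ∀ ε → 0ℚ ℚ.< ε →
  ∃[ N ] (∀ m n → N ℕ.≤ m → N ℕ.≤ n → ∣ s m ℚ.- s n ∣ ℚ.< ε)

record ℝ : Set where
  constructor mkℝ
  field
    seq    : ℕ → ℚ
    cauchy : Cauchy seq

open ℝ public

infix 4 _≈ʳ_

_≈ʳ_ : ℝ → ℝ → Set
x ≈ʳ y = ∀ ε → 0ℚ ℚ.< ε →
  ∃[ N ] (∀ n → N ℕ.≤ n → ∣ seq x n ℚ.- seq y n ∣ ℚ.< ε)

abstract

  const-cauchy : ∀ q → Cauchy (λ _ → q)
  const-cauchy q ε ε>0 =
    0 , λ _ _ _ _ → subst (λ t → ∣ t ∣ ℚ.< ε) (sym (ℚ.+-inverseʳ q)) ε>0

  neg-cauchy : ∀ {s} → Cauchy s → Cauchy (λ n → ℚ.- s n)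
  neg-cauchy {s} cs ε ε>0 with cs ε ε>0
  ... | N , h = N , λ m n p q →
    subst (ℚ._< ε)
      (trans (sym (ℚ.∣-p∣≡∣p∣ (s m ℚ.- s n)))
             (cong ∣_∣ (ℚ.neg-distrib-+ (s m) (ℚ.- s n))))
      (h m n p q)

  private
    -- One tolerance δ for both factors, with b · δ + c · δ = ε.
    split : ∀ b c ε → 0ℚ ℚ.< b → 0ℚ ℚ.< c → 0ℚ ℚ.< ε →
            ∃[ δ ] (0ℚ ℚ.< δ × b ℚ.* δ ℚ.+ c ℚ.* δ ≡ ε)
    split b c ε b>0 c>0 ε>0 = ε ℚ.* r , δ>0 , eq
      where
      instance
        posSum : Positive (b ℚ.+ c)
        posSum = positive (ℚ.+-mono-< b>0 c>0)
        nzSum : NonZero (b ℚ.+ c)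
        nzSum = ℚ.pos⇒nonZero (b ℚ.+ c)
        posε : Positive ε
        posε = positive ε>0
      r : ℚ
      r = 1/ (b ℚ.+ c)
      δ>0 : 0ℚ ℚ.< ε ℚ.* r
      δ>0 = ℚ.positive⁻¹ (ε ℚ.* r) {{ℚ.pos*pos⇒pos ε r {{ℚ.1/pos⇒pos (b ℚ.+ c)}}}}
      eq : b ℚ.* (ε ℚ.* r) ℚ.+ c ℚ.* (ε ℚ.* r) ≡ ε
      eq = trans
        (solve 4 (λ b c ε r → b :* (ε :* r) :+ c :* (ε :* r) := ε :* ((b :+ c) :* r))
               refl b c ε r)
        (trans (cong (ε ℚ.*_) (ℚ.*-inverseʳ (b ℚ.+ c))) (ℚ.*-identityʳ ε))
        where open +-*-Solver

    *-mono-bound : ∀ {p q b δ} → 0ℚ ℚ.< b → ∣ p ∣ ℚ.≤ b → ∣ q ∣ ℚ.< δ →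
                   ∣ p ℚ.* q ∣ ℚ.< b ℚ.* δ
    *-mono-bound {p} {q} {b} {δ} b>0 p≤b q<δ =
      subst (ℚ._< b ℚ.* δ) (sym (ℚ.∣p*q∣≡∣p∣*∣q∣ p q))
        (ℚ.≤-<-trans
          (ℚ.*-monoʳ-≤-nonNeg ∣ q ∣ {{ℚ.∣-∣-nonNeg q}} p≤b)
          (ℚ.*-monoʳ-<-pos b {{positive b>0}} q<δ))

    EventuallyBounded : (ℕ → ℚ) → Set
    EventuallyBounded s = ∃[ b ] ∃[ N ] (0ℚ ℚ.< b × (∀ n → N ℕ.≤ n → ∣ s n ∣ ℚ.≤ b))

    eventual-bound : ∀ {s} → Cauchy s → EventuallyBounded s
    eventual-bound {s} cs with cs 1ℚ (ℚ.positive⁻¹ 1ℚ)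
    ... | N , h = b , N , b>0 , bound
      where
      b : ℚ
      b = 1ℚ ℚ.+ ∣ s N ∣
      b>0 : 0ℚ ℚ.< b
      b>0 = ℚ.+-mono-<-≤ (ℚ.positive⁻¹ 1ℚ) (ℚ.0≤∣p∣ (s N))
      bound : ∀ n → N ℕ.≤ n → ∣ s n ∣ ℚ.≤ b
      bound n p = subst (λ t → ∣ t ∣ ℚ.≤ b)
        (solve 2 (λ u v → (u :- v) :+ v := u) refl (s n) (s N))
        (ℚ.≤-trans (ℚ.∣p+q∣≤∣p∣+∣q∣ (s n ℚ.- s N) (s N))
          (ℚ.+-monoˡ-≤ ∣ s N ∣ (ℚ.<⇒≤ (h n N p ℕ.≤-refl))))
        where open +-*-Solver

  private
    +-close : ∀ a b c d {δ γ} → ∣ a ℚ.- b ∣ ℚ.< δ → ∣ c ℚ.- d ∣ ℚ.< γ →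
              ∣ (a ℚ.+ c) ℚ.- (b ℚ.+ d) ∣ ℚ.< δ ℚ.+ γ
    +-close a b c d {δ} {γ} h k =
      subst (λ t → ∣ t ∣ ℚ.< δ ℚ.+ γ) eq
        (ℚ.≤-<-trans (ℚ.∣p+q∣≤∣p∣+∣q∣ (a ℚ.- b) (c ℚ.- d)) (ℚ.+-mono-< h k))
      where
      open +-*-Solver
      eq : (a ℚ.- b) ℚ.+ (c ℚ.- d) ≡ (a ℚ.+ c) ℚ.- (b ℚ.+ d)
      eq = solve 4 (λ a b c d → (a :- b) :+ (c :- d) := (a :+ c) :- (b :+ d))
                 refl a b c d

    *-close : ∀ a b c d {β γ δ} → 0ℚ ℚ.< β → 0ℚ ℚ.< γ →
              ∣ a ∣ ℚ.≤ β → ∣ d ∣ ℚ.≤ γ → ∣ a ℚ.- b ∣ ℚ.< δ → ∣ c ℚ.- d ∣ ℚ.< δ →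
              ∣ a ℚ.* c ℚ.- b ℚ.* d ∣ ℚ.< β ℚ.* δ ℚ.+ γ ℚ.* δ
    *-close a b c d {β} {γ} {δ} β>0 γ>0 a≤β d≤γ h k =
      subst (λ t → ∣ t ∣ ℚ.< β ℚ.* δ ℚ.+ γ ℚ.* δ) eq
        (ℚ.≤-<-trans (ℚ.∣p+q∣≤∣p∣+∣q∣ (a ℚ.* (c ℚ.- d)) (d ℚ.* (a ℚ.- b)))
          (ℚ.+-mono-< (*-mono-bound {a} {c ℚ.- d} β>0 a≤β k)
                      (*-mono-bound {d} {a ℚ.- b} γ>0 d≤γ h)))
      where
      open +-*-Solver
      eq : a ℚ.* (c ℚ.- d) ℚ.+ d ℚ.* (a ℚ.- b) ≡ a ℚ.* c ℚ.- b ℚ.* d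
      eq = solve 4 (λ a b c d → a :* (c :- d) :+ d :* (a :- b) := a :* c :- b :* d)
                 refl a b c d

    +-cauchy′ : ∀ {s t} → Cauchy s → Cauchy t → ∀ {ε} →
      ∃[ δ ] (0ℚ ℚ.< δ × 1ℚ ℚ.* δ ℚ.+ 1ℚ ℚ.* δ ≡ ε) →
      ∃[ N ] (∀ m n → N ℕ.≤ m → N ℕ.≤ n →
        ∣ (s m ℚ.+ t m) ℚ.- (s n ℚ.+ t n) ∣ ℚ.< ε)
    +-cauchy′ {s} {t} cs ct (δ , δ>0 , eq) with cs δ δ>0 | ct δ δ>0
    ... | M , h | N , k = M ⊔ N , λ m n p q →
      subst (∣ (s m ℚ.+ t m) ℚ.- (s n ℚ.+ t n) ∣ ℚ.<_)
        (trans (sym (cong₂ ℚ._+_ (ℚ.*-identityˡ δ) (ℚ.*-identityˡ δ))) eq)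
        (+-close (s m) (s n) (t m) (t n)
          (h m n (ℕ.m⊔n≤o⇒m≤o M N p) (ℕ.m⊔n≤o⇒m≤o M N q))
          (k m n (ℕ.m⊔n≤o⇒n≤o M N p) (ℕ.m⊔n≤o⇒n≤o M N q)))

    *-cauchy′ : ∀ {s t} → Cauchy s → Cauchy t →
      ∀ {b B} → 0ℚ ℚ.< b → (∀ n → B ℕ.≤ n → ∣ s n ∣ ℚ.≤ b) →
      ∀ {c C} → 0ℚ ℚ.< c → (∀ n → C ℕ.≤ n → ∣ t n ∣ ℚ.≤ c) →
      ∀ {ε} → ∃[ δ ] (0ℚ ℚ.< δ × b ℚ.* δ ℚ.+ c ℚ.* δ ≡ ε) →
      ∃[ N ] (∀ m n → N ℕ.≤ m → N ℕ.≤ n →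
        ∣ s m ℚ.* t m ℚ.- s n ℚ.* t n ∣ ℚ.< ε)
    *-cauchy′ {s} {t} cs ct {b} {B} b>0 sb {c} {C} c>0 tc (δ , δ>0 , eq)
      with cs δ δ>0 | ct δ δ>0
    ... | M , h | N , k = (B ⊔ C) ⊔ (M ⊔ N) , λ m n p q →
      let p₁ = ℕ.m⊔n≤o⇒m≤o (B ⊔ C) (M ⊔ N) p
          p₂ = ℕ.m⊔n≤o⇒n≤o (B ⊔ C) (M ⊔ N) p
          q₁ = ℕ.m⊔n≤o⇒m≤o (B ⊔ C) (M ⊔ N) q
          q₂ = ℕ.m⊔n≤o⇒n≤o (B ⊔ C) (M ⊔ N) q
      in
      subst (∣ s m ℚ.* t m ℚ.- s n ℚ.* t n ∣ ℚ.<_) eq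
        (*-close (s m) (s n) (t m) (t n) b>0 c>0
          (sb m (ℕ.m⊔n≤o⇒m≤o B C p₁)) (tc n (ℕ.m⊔n≤o⇒n≤o B C q₁))
          (h m n (ℕ.m⊔n≤o⇒m≤o M N p₂) (ℕ.m⊔n≤o⇒m≤o M N q₂))
          (k m n (ℕ.m⊔n≤o⇒n≤o M N p₂) (ℕ.m⊔n≤o⇒n≤o M N q₂)))

  +-cauchy : ∀ {s t} → Cauchy s → Cauchy t → Cauchy (λ n → s n ℚ.+ t n)
  +-cauchy {s} {t} cs ct ε ε>0 =
    +-cauchy′ {s} {t} cs ct (split 1ℚ 1ℚ ε (ℚ.positive⁻¹ 1ℚ) (ℚ.positive⁻¹ 1ℚ) ε>0)

  *-cauchy : ∀ {s t} → Cauchy s → Cauchy t → Cauchy (λ n → s n ℚ.* t n)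
  *-cauchy {s} {t} cs ct = go (eventual-bound {s} cs) (eventual-bound {t} ct)
    where
    go : EventuallyBounded s → EventuallyBounded t → Cauchy (λ n → s n ℚ.* t n)
    go (b , B , b>0 , sb) (c , C , c>0 , tc) ε ε>0 =
      *-cauchy′ {s} {t} cs ct b>0 sb c>0 tc (split b c ε b>0 c>0 ε>0)

infixl 6 _+ʳ_
infixl 7 _*ʳ_
infix  8 -ʳ_

_+ʳ_ _*ʳ_ : ℝ → ℝ → ℝ
x +ʳ y = mkℝ (λ n → seq x n ℚ.+ seq y n) (+-cauchy {seq x} {seq y} (cauchy x) (cauchy y))
x *ʳ y = mkℝ (λ n → seq x n ℚ.* seq y n) (*-cauchy {seq x} {seq y} (cauchy x) (cauchy y))

-ʳ_ : ℝ → ℝ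
-ʳ x = mkℝ (λ n → ℚ.- seq x n) (neg-cauchy {seq x} (cauchy x))

0ʳ 1ʳ : ℝ
0ʳ = mkℝ (λ _ → 0ℚ) (const-cauchy 0ℚ)
1ʳ = mkℝ (λ _ → 1ℚ) (const-cauchy 1ℚ)

record ℂ : Set where
  constructor _+i_
  field
    re im : ℝ

open ℂ public

infix  4 _≈_
infixl 6 _+_
infixl 7 _*_
infixr 8 _^_

_≈_ : ℂ → ℂ → Set
z ≈ w = (re z ≈ʳ re w) × (im z ≈ʳ im w)

_+_ _*_ : ℂ → ℂ → ℂ
z + w = (re z +ʳ re w) +i (im z +ʳ im w)
z * w = (re z *ʳ re w +ʳ -ʳ (im z *ʳ im w)) +i (re z *ʳ im w +ʳ im z *ʳ re w)

0# 1# i : ℂ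
0# = 0ʳ +i 0ʳ
1# = 1ʳ +i 0ʳ
i  = 0ʳ +i 1ʳ

conj : ℂ → ℂ
conj z = re z +i (-ʳ im z)

_^_ : ℂ → ℕ → ℂ
z ^ zero  = 1#
z ^ suc k = z * (z ^ k)

-- The multiplicative group of ℂ; z is a unit exactly when it is apart from 0.
ℂˣ : ℂ → Set
ℂˣ z = ∃[ w ] z * w ≈ 1#

-- ∣z∣ = 1, written without the square root as ∣z∣² = 1.
U₁ : ℂ → Set
U₁ z = (re z *ʳ re z) +ʳ (im z *ʳ im z) ≈ʳ 1ʳ

-- The field 𝔽₂ is Bool with _xor_ and _∧_.

Bits : ℕ → Set
Bits n = Vec Bool n

⟨_,_⟩ : ∀ {n} → Bits n → Bits n → Bool
⟨ α , x ⟩ = foldr′ _xor_ false (zipWith _∧_ α x)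

toInt : Bool → ℕ
toInt b = if b then 1 else 0

-- χ A x is 1 if A x = 0 over 𝔽₂ and 0 otherwise; A is the vector of its rows.
χ : ∀ {r k} → Vec (Bits k) r → Bits k → ℂ
χ {r} A x =
  if does (≡-dec Bool._≟_ (map (λ a → ⟨ a , x ⟩) A) (replicate r false)) then 1# else 0#

-- Since i has order 4, the exponent may be the sum in ℕ of the 0-1 terms.
affineFun : ∀ {k r m} → ℂ → Vec (Bits (suc k)) r → Vec (Bits (suc k)) m → Bits k → ℂ
affineFun lam A αs x =
  lam * (χ A x⁺ * i ^ sum (map (λ α → toInt ⟨ α , x⁺ ⟩) αs))
  where x⁺ = x ∷ʳ true

Affine : ∀ {k} → (Bits k → ℂ) → Set
Affine {k} f =
  ∃[ lam ] ∃[ r ] ∃[ m ]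
  Σ[ A ∈ Vec (Bits (suc k)) r ] Σ[ αs ∈ Vec (Bits (suc k)) m ]
  (∀ x → f x ≈ affineFun lam A αs x)

-- 2ⁿ × 2ⁿ matrices: rows and columns are indexed by {0,1}ⁿ.
Matrix : ℕ → Set
Matrix n = Bits n → Bits n → ℂ

infix  4 _≋_
infixl 7 _⊗_ _·_

_≋_ : ∀ {n} → Matrix n → Matrix n → Set
M ≋ N = ∀ x y → M x y ≈ N x y

∑ : ∀ {n} → (Bits n → ℂ) → ℂ
∑ {zero}  f = f []
∑ {suc n} f = ∑ (λ x → f (false ∷ x)) + ∑ (λ x → f (true ∷ x))

_⊗_ : ∀ {n} → Matrix n → Matrix n → Matrix n
(M ⊗ N) x y = ∑ λ z → M x z * N z y

_·_ : ∀ {n} → ℂ → Matrix n → Matrix n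
(c · M) x y = c * M x y

I : ∀ {n} → Matrix n
I x y = if does (≡-dec Bool._≟_ x y) then 1# else 0#

_† : ∀ {n} → Matrix n → Matrix n
(M †) x y = conj (M y x)

GL : ∀ {n} → Matrix n → Set
GL {n} M = Σ[ N ∈ Matrix n ] (M ⊗ N ≋ I) × (N ⊗ M ≋ I)

U : ∀ {n} → Matrix n → Set
U M = (M ⊗ (M †) ≋ I) × ((M †) ⊗ M ≋ I)

-- The column index is (x₂ₙ , … , xₙ₊₁), so it is reversed to recover xₙ₊₁ , … , x₂ₙ.
signatureMatrix : ∀ {n} → (Bits (n ℕ.+ n) → ℂ) → Matrix n
signatureMatrix f x y = f (x ++ reverse y)

𝒜 : ∀ n → Matrix n → Set
𝒜 n M = Σ[ f ∈ (Bits (n ℕ.+ n) → ℂ) ] Affine f × (M ≋ signatureMatrix f)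

𝒢𝒜 𝒰𝒜 : ∀ n → Matrix n → Set
𝒢𝒜 n M = GL M × 𝒜 n M
𝒰𝒜 n M = U M × 𝒜 n M

infix 4 _~[_]_ _⊆_mod_ _/_≐_/_

_~[_]_ : ∀ {n} → Matrix n → (ℂ → Set) → Matrix n → Set
M ~[ S ] N = ∃[ c ] S c × (M ≋ c · N)

-- Every class modulo S of an element of P is the class of some element of Q.
_⊆_mod_ : ∀ {n} → (Matrix n → Set) → (Matrix n → Set) → (ℂ → Set) → Set
P ⊆ Q mod S = ∀ M → P M → ∃[ N ] Q N × (M ~[ S ] N)

-- P / S and Q / T are the same set of classes. If S = T this is equality of the
-- two sets of classes. If T is a proper subgroup of S, the class modulo T of an
-- element of Q is identified with the class modulo S containing it, and the last
-- clause says that this identification merges no two classes of Q / T.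
--
-- It is applied to 𝒢𝒜 n / ℂˣ and 𝒰𝒜 n / U₁. The factor λ of an affine function
-- is an arbitrary complex number, so 𝒢𝒜 n contains 2 · I, which is not a unitary
-- matrix up to a factor of norm one: 𝒢𝒜 n / U₁ is strictly larger than 𝒰𝒜 n / U₁,
-- and the nonsingular side has to be taken modulo all nonzero scalars.
_/_≐_/_ : ∀ {n} → (Matrix n → Set) → (ℂ → Set) → (Matrix n → Set) → (ℂ → Set) → Set
P / S ≐ Q / T =
  (P ⊆ Q mod S) ×
  (Q ⊆ P mod T) ×
  (∀ M N → Q M → Q N → (M ~[ S ] N) ⇔ (M ~[ T ] N))

{-# OPTIONS --safe #-}
module Submission where

-- Write M = λ g with g x y = χ(x, y) i^Q(x, y). By affineness the supports of the
-- rows of g are empty or translates of one subspace K of 𝔽₂ⁿ, so a nonempty row has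
-- squared norm |K| = 2ᵏ. For two rows x ≠ x′, translating y by d ∈ K changes
-- i^(Q(x, y) − Q(x′, y)) by a sign that depends on d only. If some sign is −1, the
-- inner product of the rows equals its own negative and vanishes; otherwise the rows
-- have disjoint supports or are proportional, and the latter contradicts invertibility.
-- Hence g g† = 2ᵏ I. Since ∣1 + i∣² = 2, g / (1 + i)ᵏ is unitary, with no square root.

open import Defs
open import Data.Nat using (ℕ)
open import Algebra.Bundles using (CommutativeRing)
open import Data.Bool using (Bool; true; false; _∧_; _xor_; if_then_else_)
import Data.Bool.Properties as Bool
open import Data.Empty using (⊥-elim)
open import Data.Nat as ℕ using (zero; suc; _⊔_)
import Data.Nat.Properties as ℕ
open import Data.Product using (∃-syntax; _×_; _,_; proj₁; proj₂)
open import Data.Rational as ℚ using (ℚ; 0ℚ; 1ℚ; ½; ∣_∣; NonZero; Positive; positive; 1/_)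
import Data.Rational.Properties as ℚ
open import Data.Rational.Solver using (module +-*-Solver)
open import Data.Sum using (_⊎_; inj₁; inj₂; [_,_]′)
open import Data.Vec using (Vec; []; _∷_; _∷ʳ_; _++_; map; replicate; reverse; sum; zipWith)
open import Data.Vec.Properties
  using (≡-dec; reverse-∷; zipWith-++; zipWith-assoc; zipWith-comm;
         zipWith-identityˡ; zipWith-identityʳ)
open import Function.Bundles using (mk⇔)
open import Level using (0ℓ)
open import Relation.Binary.PropositionalEquality
  using (_≡_; _≢_; refl; sym; trans; cong; cong₂; subst)
open import Relation.Binary.Bundles using (Setoid)
open import Relation.Binary.Structures using (IsEquivalence)
open import Relation.Nullary using (¬_; Dec; yes; no; does)
open import Relation.Nullary.Decidable using (dec-true)

-- Real and complex arithmetic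

-- `x ≈ʳ y` unfolds to `Null` of the termwise difference, so the laws of `≈ʳ` reduce to closure
-- properties of null sequences.
Null : (ℕ → ℚ) → Set
Null s = ∀ ε → 0ℚ ℚ.< ε → ∃[ N ] (∀ n → N ℕ.≤ n → ∣ s n ∣ ℚ.< ε)

Null-resp : ∀ {s t} → (∀ n → s n ≡ t n) → Null s → Null t
Null-resp s≡t s→0 ε ε>0 with s→0 ε ε>0
... | N , h = N , λ n p → subst (λ q → ∣ q ∣ ℚ.< ε) (s≡t n) (h n p)

Null-0 : Null (λ _ → 0ℚ)
Null-0 ε ε>0 = 0 , λ _ _ → ε>0

Null-neg : ∀ {s} → Null s → Null (λ n → ℚ.- s n)
Null-neg {s} s→0 ε ε>0 with s→0 ε ε>0
... | N , h = N , λ n p → subst (ℚ._< ε) (sym (ℚ.∣-p∣≡∣p∣ (s n))) (h n p)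

Null-+ : ∀ {s t} → Null s → Null t → Null (λ n → s n ℚ.+ t n)
Null-+ {s} {t} s→0 t→0 ε ε>0 = M ⊔ N , λ n p →
  subst (∣ s n ℚ.+ t n ∣ ℚ.<_) δ+δ≡ε
    (ℚ.≤-<-trans (ℚ.∣p+q∣≤∣p∣+∣q∣ (s n) (t n))
      (ℚ.+-mono-< (proj₂ (s→0 δ δ>0) n (ℕ.m⊔n≤o⇒m≤o M N p))
                  (proj₂ (t→0 δ δ>0) n (ℕ.m⊔n≤o⇒n≤o M N p))))
  where
  δ = ½ ℚ.* ε
  δ>0 : 0ℚ ℚ.< δ
  δ>0 = ℚ.positive⁻¹ δ {{ℚ.pos*pos⇒pos ½ ε {{positive ε>0}}}}
  M = proj₁ (s→0 δ δ>0)
  N = proj₁ (t→0 δ δ>0)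
  δ+δ≡ε : δ ℚ.+ δ ≡ ε
  δ+δ≡ε = trans (sym (ℚ.*-distribʳ-+ ε ½ ½)) (ℚ.*-identityˡ ε)

-- The Cauchy condition at tolerance 1 bounds `seq x` by `b` from index `M` on, so it suffices that
-- `s` falls below ε / b.
Null-* : ∀ (x : ℝ) {s} → Null s → Null (λ n → seq x n ℚ.* s n)
Null-* x {s} s→0 ε ε>0 = M ⊔ N , λ n p →
  subst (∣ seq x n ℚ.* s n ∣ ℚ.<_) bδ≡ε
    (subst (ℚ._< b ℚ.* δ) (sym (ℚ.∣p*q∣≡∣p∣*∣q∣ (seq x n) (s n)))
      (ℚ.≤-<-trans
        (ℚ.*-monoʳ-≤-nonNeg ∣ s n ∣ {{ℚ.∣-∣-nonNeg (s n)}} (bound n (ℕ.m⊔n≤o⇒m≤o M N p)))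
        (ℚ.*-monoʳ-<-pos b (proj₂ (s→0 δ δ>0) n (ℕ.m⊔n≤o⇒n≤o M N p)))))
  where
  M = proj₁ (cauchy x 1ℚ (ℚ.positive⁻¹ 1ℚ))
  b = 1ℚ ℚ.+ ∣ seq x M ∣
  instance
    b-pos : Positive b
    b-pos = positive (ℚ.+-mono-<-≤ (ℚ.positive⁻¹ 1ℚ) (ℚ.0≤∣p∣ (seq x M)))
    b-nonZero : NonZero b
    b-nonZero = ℚ.pos⇒nonZero b
    ε-pos : Positive ε
    ε-pos = positive ε>0
  δ = (1/ b) ℚ.* ε
  δ>0 : 0ℚ ℚ.< δ
  δ>0 = ℚ.positive⁻¹ δ {{ℚ.pos*pos⇒pos (1/ b) {{ℚ.1/pos⇒pos b}} ε}}
  N = proj₁ (s→0 δ δ>0)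
  bδ≡ε : b ℚ.* δ ≡ ε
  bδ≡ε = trans (sym (ℚ.*-assoc b (1/ b) ε))
    (trans (cong (ℚ._* ε) (ℚ.*-inverseʳ b)) (ℚ.*-identityˡ ε))
  bound : ∀ n → M ℕ.≤ n → ∣ seq x n ∣ ℚ.≤ b
  bound n p = subst (λ t → ∣ t ∣ ℚ.≤ b)
    (solve 2 (λ u v → (u :- v) :+ v := u) refl (seq x n) (seq x M))
    (ℚ.≤-trans (ℚ.∣p+q∣≤∣p∣+∣q∣ (seq x n ℚ.- seq x M) (seq x M))
      (ℚ.+-monoˡ-≤ ∣ seq x M ∣
        (ℚ.<⇒≤ (proj₂ (cauchy x 1ℚ (ℚ.positive⁻¹ 1ℚ)) n M p ℕ.≤-refl))))
    where open +-*-Solver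

-- _≈ʳ_ and _≈_ unfold, so their arguments cannot be inferred from a proof; the
-- records can be, and serve as the equalities of the algebraic structures.
infix 4 _≃ʳ_ _≃_

record _≃ʳ_ (x y : ℝ) : Set where
  constructor wrapʳ
  field unwrapʳ : x ≈ʳ y

record _≃_ (z w : ℂ) : Set where
  constructor wrap
  field unwrap : z ≈ w

open _≃ʳ_
open _≃_

-- Turns an identity of reals into termwise identities of rationals, where the ring solver or plain
-- computation applies.
pointwise : ∀ {x y} → (∀ n → seq x n ≡ seq y n) → x ≃ʳ y
pointwise {x} {y} eq = wrapʳ (Null-resp {λ _ → 0ℚ}
  (λ n → trans (sym (ℚ.+-inverseʳ (seq y n))) (cong (ℚ._- seq y n) (sym (eq n)))) Null-0)

≃ʳ-sym : ∀ {x y} → x ≃ʳ y → y ≃ʳ x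
≃ʳ-sym {x} {y} (wrapʳ e) = wrapʳ (Null-resp
  (λ n → solve 2 (λ a b → :- (a :- b) := b :- a) refl (seq x n) (seq y n)) (Null-neg e))
  where open +-*-Solver

≃ʳ-trans : ∀ {x y z} → x ≃ʳ y → y ≃ʳ z → x ≃ʳ z
≃ʳ-trans {x} {y} {z} (wrapʳ e) (wrapʳ f) = wrapʳ (Null-resp
  (λ n → solve 3 (λ a b c → (a :- b) :+ (b :- c) := a :- c) refl (seq x n) (seq y n) (seq z n))
  (Null-+ e f))
  where open +-*-Solver

+ʳ-cong : ∀ {x x′ y y′} → x ≃ʳ x′ → y ≃ʳ y′ → x +ʳ y ≃ʳ x′ +ʳ y′
+ʳ-cong {x} {x′} {y} {y′} (wrapʳ e) (wrapʳ f) = wrapʳ (Null-resp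
  (λ n → solve 4 (λ a b c d → (a :- b) :+ (c :- d) := (a :+ c) :- (b :+ d)) refl
    (seq x n) (seq x′ n) (seq y n) (seq y′ n))
  (Null-+ e f))
  where open +-*-Solver

-ʳ-cong : ∀ {x y} → x ≃ʳ y → -ʳ x ≃ʳ -ʳ y
-ʳ-cong {x} {y} (wrapʳ e) = wrapʳ (Null-resp
  (λ n → solve 2 (λ a b → :- (a :- b) := :- a :- (:- b)) refl (seq x n) (seq y n)) (Null-neg e))
  where open +-*-Solver

*ʳ-cong : ∀ {x x′ y y′} → x ≃ʳ x′ → y ≃ʳ y′ → x *ʳ y ≃ʳ x′ *ʳ y′
*ʳ-cong {x} {x′} {y} {y′} (wrapʳ e) (wrapʳ f) = wrapʳ (Null-resp
  -- The difference x y - x′ y′ is split as y (x - x′) + x′ (y - y′), a sum of null sequences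
  -- multiplied by reals.
  (λ n → solve 4 (λ a b c d → c :* (a :- b) :+ b :* (c :- d) := a :* c :- b :* d) refl
    (seq x n) (seq x′ n) (seq y n) (seq y′ n))
  (Null-+ (Null-* y e) (Null-* x′ f)))
  where open +-*-Solver

componentwise : ∀ {z w} → re z ≃ʳ re w → im z ≃ʳ im w → z ≃ w
componentwise (wrapʳ e) (wrapʳ f) = wrap (e , f)

re-cong : ∀ {z w} → z ≃ w → re z ≃ʳ re w
re-cong (wrap e) = wrapʳ (proj₁ e)

im-cong : ∀ {z w} → z ≃ w → im z ≃ʳ im w
im-cong (wrap e) = wrapʳ (proj₂ e)

-ᶜ_ : ℂ → ℂ
-ᶜ z = (-ʳ re z) +i (-ʳ im z)

+-cong : ∀ {z z′ w w′} → z ≃ z′ → w ≃ w′ → z + w ≃ z′ + w′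
+-cong e f = componentwise (+ʳ-cong (re-cong e) (re-cong f)) (+ʳ-cong (im-cong e) (im-cong f))

*-cong : ∀ {z z′ w w′} → z ≃ z′ → w ≃ w′ → z * w ≃ z′ * w′
*-cong e f = componentwise
  (+ʳ-cong (*ʳ-cong (re-cong e) (re-cong f)) (-ʳ-cong (*ʳ-cong (im-cong e) (im-cong f))))
  (+ʳ-cong (*ʳ-cong (re-cong e) (im-cong f)) (*ʳ-cong (im-cong e) (re-cong f)))

-ᶜ-cong : ∀ {z w} → z ≃ w → -ᶜ z ≃ -ᶜ w
-ᶜ-cong e = componentwise (-ʳ-cong (re-cong e)) (-ʳ-cong (im-cong e))

≃-isEquivalence : IsEquivalence _≃_
≃-isEquivalence = record
  { refl  = componentwise (pointwise λ _ → refl) (pointwise λ _ → refl)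
  ; sym   = λ e → componentwise (≃ʳ-sym (re-cong e)) (≃ʳ-sym (im-cong e))
  ; trans = λ e f →
      componentwise (≃ʳ-trans (re-cong e) (re-cong f)) (≃ʳ-trans (im-cong e) (im-cong f))
  }

ℂ-setoid : Setoid 0ℓ 0ℓ
ℂ-setoid = record { isEquivalence = ≃-isEquivalence }

*-assoc : ∀ z w v → (z * w) * v ≃ z * (w * v)
*-assoc z w v = componentwise
  (pointwise λ n → solve 6 (λ a b c d e f →
      (a :* c :+ :- (b :* d)) :* e :+ :- ((a :* d :+ b :* c) :* f) :=
      a :* (c :* e :+ :- (d :* f)) :+ :- (b :* (c :* f :+ d :* e)))
    refl (seq (re z) n) (seq (im z) n) (seq (re w) n) (seq (im w) n) (seq (re v) n) (seq (im v) n))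
  (pointwise λ n → solve 6 (λ a b c d e f →
      (a :* c :+ :- (b :* d)) :* f :+ (a :* d :+ b :* c) :* e :=
      a :* (c :* f :+ d :* e) :+ b :* (c :* e :+ :- (d :* f)))
    refl (seq (re z) n) (seq (im z) n) (seq (re w) n) (seq (im w) n) (seq (re v) n) (seq (im v) n))
  where open +-*-Solver

*-comm : ∀ z w → z * w ≃ w * z
*-comm z w = componentwise
  (pointwise λ n → solve 4 (λ a b c d → a :* c :+ :- (b :* d) := c :* a :+ :- (d :* b))
    refl (seq (re z) n) (seq (im z) n) (seq (re w) n) (seq (im w) n))
  (pointwise λ n → solve 4 (λ a b c d → a :* d :+ b :* c := c :* b :+ d :* a)
    refl (seq (re z) n) (seq (im z) n) (seq (re w) n) (seq (im w) n))
  where open +-*-Solver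

*-identityˡ : ∀ z → 1# * z ≃ z
*-identityˡ z = componentwise
  (pointwise λ n → solve 2 (λ a b → con 1ℚ :* a :+ :- (con 0ℚ :* b) := a)
    refl (seq (re z) n) (seq (im z) n))
  (pointwise λ n → solve 2 (λ a b → con 1ℚ :* b :+ con 0ℚ :* a := b)
    refl (seq (re z) n) (seq (im z) n))
  where open +-*-Solver

*-distribˡ-+ : ∀ z w v → z * (w + v) ≃ z * w + z * v
*-distribˡ-+ z w v = componentwise
  (pointwise λ n → solve 6 (λ a b c d e f →
      a :* (c :+ e) :+ :- (b :* (d :+ f)) :=
      (a :* c :+ :- (b :* d)) :+ (a :* e :+ :- (b :* f)))
    refl (seq (re z) n) (seq (im z) n) (seq (re w) n) (seq (im w) n) (seq (re v) n) (seq (im v) n))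
  (pointwise λ n → solve 6 (λ a b c d e f →
      a :* (d :+ f) :+ b :* (c :+ e) := (a :* d :+ b :* c) :+ (a :* f :+ b :* e))
    refl (seq (re z) n) (seq (im z) n) (seq (re w) n) (seq (im w) n) (seq (re v) n) (seq (im v) n))
  where open +-*-Solver

ℂ-commutativeRing : CommutativeRing 0ℓ 0ℓ
ℂ-commutativeRing = record
  { Carrier = ℂ
  ; _≈_ = _≃_
  ; _+_ = _+_
  ; _*_ = _*_
  ; -_ = -ᶜ_
  ; 0# = 0#
  ; 1# = 1#
  ; isCommutativeRing = record
    { isRing = record
      { +-isAbelianGroup = record
        { isGroup = record
          { isMonoid = record
            { isSemigroup = record
              { isMagma = record { isEquivalence = ≃-isEquivalence ; ∙-cong = +-cong }
              ; assoc = λ z w v → componentwise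
                  (pointwise λ n → ℚ.+-assoc (seq (re z) n) (seq (re w) n) (seq (re v) n))
                  (pointwise λ n → ℚ.+-assoc (seq (im z) n) (seq (im w) n) (seq (im v) n))
              }
            ; identity = comm∧idˡ⇒id +-comm (λ z → componentwise
                (pointwise λ n → ℚ.+-identityˡ (seq (re z) n))
                (pointwise λ n → ℚ.+-identityˡ (seq (im z) n)))
            }
          ; inverse = comm∧invˡ⇒inv +-comm (λ z → componentwise
              (pointwise λ n → ℚ.+-inverseˡ (seq (re z) n))
              (pointwise λ n → ℚ.+-inverseˡ (seq (im z) n)))
          ; ⁻¹-cong = -ᶜ-cong
          }
        ; comm = +-comm
        }
      ; *-cong = *-cong
      ; *-assoc = *-assoc
      ; *-identity = comm∧idˡ⇒id *-comm *-identityˡ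
      ; distrib = comm∧distrˡ⇒distr +-cong *-comm *-distribˡ-+
      }
    ; *-comm = *-comm
    }
  }
  where
  open import Algebra.Consequences.Setoid ℂ-setoid
  +-comm : ∀ z w → z + w ≃ w + z
  +-comm z w = componentwise
    (pointwise λ n → ℚ.+-comm (seq (re z) n) (seq (re w) n))
    (pointwise λ n → ℚ.+-comm (seq (im z) n) (seq (im w) n))

conj-cong : ∀ {z w} → z ≃ w → conj z ≃ conj w
conj-cong e = componentwise (re-cong e) (-ʳ-cong (im-cong e))

conj-* : ∀ z w → conj (z * w) ≃ conj z * conj w
conj-* z w = componentwise
  (pointwise λ n → solve 4 (λ a b c d → a :* c :+ :- (b :* d) := a :* c :+ :- (:- b :* :- d))
    refl (seq (re z) n) (seq (im z) n) (seq (re w) n) (seq (im w) n))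
  (pointwise λ n → solve 4 (λ a b c d → :- (a :* d :+ b :* c) := a :* (:- d) :+ (:- b) :* c)
    refl (seq (re z) n) (seq (im z) n) (seq (re w) n) (seq (im w) n))
  where open +-*-Solver

*-conj : ∀ z → z * conj z ≃ (re z *ʳ re z +ʳ im z *ʳ im z) +i 0ʳ
*-conj z = componentwise
  (pointwise λ n → solve 2 (λ a b → a :* a :+ :- (b :* :- b) := a :* a :+ b :* b)
    refl (seq (re z) n) (seq (im z) n))
  (pointwise λ n → solve 2 (λ a b → a :* :- b :+ b :* a := con 0ℚ)
    refl (seq (re z) n) (seq (im z) n))
  where open +-*-Solver

1≄0 : ¬ 1# ≃ 0#
1≄0 (wrap (e , _)) with e 1ℚ (ℚ.positive⁻¹ 1ℚ)
... | N , h = ℚ.<-irrefl refl (h N ℕ.≤-refl)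

module ≃ = IsEquivalence ≃-isEquivalence

U₁⇒*-conj : ∀ {c} → U₁ c → c * conj c ≃ 1#
U₁⇒*-conj {c} u = ≃.trans (*-conj c) (componentwise (wrapʳ u) (pointwise λ _ → refl))

*-conj⇒U₁ : ∀ {c} → c * conj c ≃ 1# → U₁ c
*-conj⇒U₁ {c} e = unwrapʳ (re-cong (≃.trans (≃.sym (*-conj c)) e))

open CommutativeRing ℂ-commutativeRing
  using (setoid; +-comm; +-identityˡ; +-identityʳ; -‿inverseʳ; *-identityʳ; distribʳ; zeroˡ; zeroʳ)
open import Relation.Binary.Reasoning.Setoid setoid
open import Algebra.Properties.CommutativeSemigroup
  (CommutativeRing.+-commutativeSemigroup ℂ-commutativeRing)
  using () renaming (interchange to +-interchange)
open import Algebra.Properties.CommutativeSemigroup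
  (CommutativeRing.*-commutativeSemigroup ℂ-commutativeRing)
  using (x∙yz≈y∙xz; x∙yz≈yx∙z) renaming (interchange to *-interchange)
open import Algebra.Properties.Ring (CommutativeRing.ring ℂ-commutativeRing)
  using () renaming (-1*x≈-x to -1*z≃-z)

-- Sums over {0,1}ⁿ and matrices

∑-cong : ∀ {n} {f g : Bits n → ℂ} → (∀ x → f x ≃ g x) → ∑ f ≃ ∑ g
∑-cong {zero}  e = e []
∑-cong {suc n} e = +-cong (∑-cong λ x → e (false ∷ x)) (∑-cong λ x → e (true ∷ x))

∑-0 : ∀ n → ∑ {n} (λ _ → 0#) ≃ 0#
∑-0 zero    = ≃.refl
∑-0 (suc n) = ≃.trans (+-cong (∑-0 n) (∑-0 n)) (+-identityʳ 0#)

∑-+ : ∀ {n} (f g : Bits n → ℂ) → ∑ (λ x → f x + g x) ≃ ∑ f + ∑ g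
∑-+ {zero}  f g = ≃.refl
∑-+ {suc n} f g =
  ≃.trans (+-cong (∑-+ (λ x → f (false ∷ x)) λ x → g (false ∷ x))
                  (∑-+ (λ x → f (true ∷ x)) λ x → g (true ∷ x)))
          (+-interchange _ _ _ _)

*-∑ : ∀ {n} c (f : Bits n → ℂ) → c * ∑ f ≃ ∑ (λ x → c * f x)
*-∑ {zero}  c f = ≃.refl
*-∑ {suc n} c f =
  ≃.trans (*-distribˡ-+ c _ _) (+-cong (*-∑ c λ x → f (false ∷ x)) (*-∑ c λ x → f (true ∷ x)))

∑-* : ∀ {n} c (f : Bits n → ℂ) → ∑ f * c ≃ ∑ (λ x → f x * c)
∑-* c f = ≃.trans (*-comm _ c) (≃.trans (*-∑ c f) (∑-cong λ x → *-comm c (f x)))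

∑-swap : ∀ {m n} (f : Bits m → Bits n → ℂ) →
  ∑ (λ x → ∑ (λ y → f x y)) ≃ ∑ (λ y → ∑ (λ x → f x y))
∑-swap {zero}  f = ≃.refl
∑-swap {suc m} f =
  ≃.trans (+-cong (∑-swap λ x → f (false ∷ x)) (∑-swap λ x → f (true ∷ x)))
          (≃.sym (∑-+ (λ y → ∑ λ x → f (false ∷ x) y) (λ y → ∑ λ x → f (true ∷ x) y)))

-- Vectors and subspaces over 𝔽₂

infixl 6 _⊕_

_⊕_ : ∀ {n} → Bits n → Bits n → Bits n
_⊕_ = zipWith _xor_

𝟎 : ∀ {n} → Bits n
𝟎 {n} = replicate n false

⊕-comm : ∀ {n} (x y : Bits n) → x ⊕ y ≡ y ⊕ x
⊕-comm = zipWith-comm Bool.xor-comm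

⊕-assoc : ∀ {n} (x y z : Bits n) → (x ⊕ y) ⊕ z ≡ x ⊕ (y ⊕ z)
⊕-assoc = zipWith-assoc Bool.xor-assoc

⊕-identityˡ : ∀ {n} (x : Bits n) → 𝟎 ⊕ x ≡ x
⊕-identityˡ = zipWith-identityˡ Bool.xor-identityˡ

⊕-identityʳ : ∀ {n} (x : Bits n) → x ⊕ 𝟎 ≡ x
⊕-identityʳ = zipWith-identityʳ Bool.xor-identityʳ

⊕-same : ∀ {n} (x : Bits n) → x ⊕ x ≡ 𝟎
⊕-same []      = refl
⊕-same (b ∷ x) = cong₂ _∷_ (Bool.xor-same b) (⊕-same x)

⊕-cancelʳ : ∀ {n} (x y : Bits n) → (x ⊕ y) ⊕ y ≡ x
⊕-cancelʳ x y = trans (⊕-assoc x y y) (trans (cong (x ⊕_) (⊕-same y)) (⊕-identityʳ x))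

-- Equality in ℂ cannot be decided constructively, so cases are split by exhaustive search over
-- Boolean data instead.
search : ∀ {n} (P : Bits n → Bool) → (∃[ x ] P x ≡ true) ⊎ (∀ x → P x ≡ false)
search {zero} P with P [] in eq
... | true  = inj₁ ([] , eq)
... | false = inj₂ λ { [] → eq }
search {suc n} P with search (λ x → P (false ∷ x)) | search (λ x → P (true ∷ x))
... | inj₁ (x , eq) | _             = inj₁ (false ∷ x , eq)
... | inj₂ _        | inj₁ (x , eq) = inj₁ (true ∷ x , eq)
... | inj₂ h        | inj₂ k        = inj₂ λ { (false ∷ x) → h x ; (true ∷ x) → k x }

∑-translate : ∀ {n} d (f : Bits n → ℂ) → ∑ (λ x → f (d ⊕ x)) ≃ ∑ f
∑-translate []          f = ≃.refl
∑-translate (false ∷ d) f =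
  +-cong (∑-translate d λ x → f (false ∷ x)) (∑-translate d λ x → f (true ∷ x))
∑-translate (true ∷ d)  f =
  ≃.trans (+-cong (∑-translate d λ x → f (true ∷ x)) (∑-translate d λ x → f (false ∷ x)))
          (+-comm (∑ λ x → f (true ∷ x)) (∑ λ x → f (false ∷ x)))

𝟙 : Bool → ℂ
𝟙 b = if b then 1# else 0#

-- Over 𝔽₂ a subspace is a subset containing 0 and closed under addition. Since d + d = 0, closure
-- amounts to invariance of the indicator under translation, the form used later.
record IsSubspace {n} (K : Bits n → Bool) : Set where
  field
    contains-𝟎 : K 𝟎 ≡ true
    translate  : ∀ d x → K d ≡ true → K (d ⊕ x) ≡ K x

2# : ℂ
2# = 1# + 1#

+-double : ∀ z → z + z ≃ 2# * z
+-double z = ≃.sym (≃.trans (distribʳ z 1# 1#) (+-cong (*-identityˡ z) (*-identityˡ z)))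

-- The vectors of `K` with first bit 0 form a subspace of one dimension less in the ambient space.
-- Those with first bit 1 are either absent or a translate of it, so the count stays or doubles.
∑-subspace : ∀ {n} (K : Bits n → Bool) → IsSubspace K →
  ∃[ k ] ∑ (λ x → 𝟙 (K x)) ≃ 2# ^ k
∑-subspace {zero}  K sub rewrite IsSubspace.contains-𝟎 sub = 0 , ≃.refl
∑-subspace {suc n} K sub with ∑-subspace (λ x → K (false ∷ x)) (record
    { contains-𝟎 = contains-𝟎 ; translate = λ d x → translate (false ∷ d) (false ∷ x) })
  where open IsSubspace sub
... | k , card with search (λ x → K (true ∷ x))
...   | inj₂ none = k ,
  ≃.trans (+-cong card (≃.trans (∑-cong λ x → ≃.reflexive (cong 𝟙 (none x))) (∑-0 n)))
          (+-identityʳ (2# ^ k))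
...   | inj₁ (d , d∈K) = suc k ,
  ≃.trans (+-cong card
            (≃.trans (≃.sym (∑-translate d λ x → 𝟙 (K (true ∷ x))))
              (≃.trans (∑-cong λ x → ≃.reflexive (cong 𝟙
                (shift x))) card)))
          (+-double (2# ^ k))
  where
  shift : ∀ x → K (true ∷ (d ⊕ x)) ≡ K (false ∷ x)
  shift x = IsSubspace.translate sub (true ∷ d) (false ∷ x) d∈K

-- Matrix algebra

I-*-∑ : ∀ {n} (x : Bits n) (f : Bits n → ℂ) → ∑ (λ z → I x z * f z) ≃ f x
I-*-∑ []          f = *-identityˡ (f [])
I-*-∑ {suc n} (false ∷ x) f =
  ≃.trans (+-cong (I-*-∑ x λ z → f (false ∷ z))
            (≃.trans (∑-cong λ z → zeroˡ (f (true ∷ z))) (∑-0 n)))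
          (+-identityʳ (f (false ∷ x)))
I-*-∑ {suc n} (true ∷ x)  f =
  ≃.trans (+-cong (≃.trans (∑-cong λ z → zeroˡ (f (false ∷ z))) (∑-0 n))
            (I-*-∑ x λ z → f (true ∷ z)))
          (+-identityˡ (f (true ∷ x)))

I-sym : ∀ {n} (x y : Bits n) → I x y ≡ I y x
I-sym []          []          = refl
I-sym (false ∷ x) (false ∷ y) = I-sym x y
I-sym (true ∷ x)  (true ∷ y)  = I-sym x y
I-sym (false ∷ x) (true ∷ y)  = refl
I-sym (true ∷ x)  (false ∷ y) = refl

I-diagonal : ∀ {n} (x : Bits n) → I x x ≡ 1#
I-diagonal []          = refl
I-diagonal (false ∷ x) = I-diagonal x
I-diagonal (true ∷ x)  = I-diagonal x

infix 4 _≃ᵐ_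

_≃ᵐ_ : ∀ {n} → Matrix n → Matrix n → Set
M ≃ᵐ N = ∀ x y → M x y ≃ N x y

⊗-cong : ∀ {n} {M M′ N N′ : Matrix n} → M ≃ᵐ M′ → N ≃ᵐ N′ → M ⊗ N ≃ᵐ M′ ⊗ N′
⊗-cong e f x y = ∑-cong λ z → *-cong (e x z) (f z y)

⊗-assoc : ∀ {n} (L M N : Matrix n) → (L ⊗ M) ⊗ N ≃ᵐ L ⊗ (M ⊗ N)
⊗-assoc L M N x y = begin
  ∑ (λ w → ∑ (λ z → L x z * M z w) * N w y)
    ≈⟨ ∑-cong (λ w → ∑-* (N w y) (λ z → L x z * M z w)) ⟩
  ∑ (λ w → ∑ (λ z → L x z * M z w * N w y))
    ≈⟨ ∑-swap (λ w z → L x z * M z w * N w y) ⟩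
  ∑ (λ z → ∑ (λ w → L x z * M z w * N w y))
    ≈⟨ ∑-cong (λ z → ∑-cong λ w → *-assoc (L x z) (M z w) (N w y)) ⟩
  ∑ (λ z → ∑ (λ w → L x z * (M z w * N w y)))
    ≈⟨ ∑-cong (λ z → *-∑ (L x z) (λ w → M z w * N w y)) ⟨
  ∑ (λ z → L x z * ∑ (λ w → M z w * N w y)) ∎

⊗-identityˡ : ∀ {n} (M : Matrix n) → I ⊗ M ≃ᵐ M
⊗-identityˡ M x y = I-*-∑ x λ z → M z y

⊗-identityʳ : ∀ {n} (M : Matrix n) → M ⊗ I ≃ᵐ M
⊗-identityʳ M x y = ≃.trans
  (∑-cong λ z → ≃.trans (*-comm (M x z) (I z y)) (≃.reflexive (cong (_* M x z) (I-sym z y))))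
  (I-*-∑ y λ z → M x z)

·-⊗ : ∀ {n} c (M N : Matrix n) → (c · M) ⊗ N ≃ᵐ c · (M ⊗ N)
·-⊗ c M N x y = ≃.trans (∑-cong λ z → *-assoc c (M x z) (N z y))
  (≃.sym (*-∑ c λ z → M x z * N z y))

⊗-· : ∀ {n} c (M N : Matrix n) → M ⊗ (c · N) ≃ᵐ c · (M ⊗ N)
⊗-· c M N x y = ≃.trans (∑-cong λ z → x∙yz≈y∙xz (M x z) c (N z y))
  (≃.sym (*-∑ c λ z → M x z * N z y))

-- R = (L M) R = L (M R) = L. This yields M† M = I from M M† = I, the only one of the two products
-- that is computed from rows.
right-inverse⇒left-inverse : ∀ {n} (L M R : Matrix n) →
  L ⊗ M ≃ᵐ I → M ⊗ R ≃ᵐ I → R ⊗ M ≃ᵐ I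
right-inverse⇒left-inverse L M R LM≃I MR≃I x y =
  ≃.trans (⊗-cong {M = R} {L} {M} {M} R≃L (λ _ _ → ≃.refl) x y) (LM≃I x y)
  where
  R≃L : R ≃ᵐ L
  R≃L x y = begin
    R x y             ≈⟨ ⊗-identityˡ R x y ⟨
    (I ⊗ R) x y       ≈⟨ ⊗-cong {M = L ⊗ M} {I} {R} {R} LM≃I (λ _ _ → ≃.refl) x y ⟨
    ((L ⊗ M) ⊗ R) x y ≈⟨ ⊗-assoc L M R x y ⟩
    (L ⊗ (M ⊗ R)) x y ≈⟨ ⊗-cong {M = L} {L} {M ⊗ R} {I} (λ _ _ → ≃.refl) MR≃I x y ⟩
    (L ⊗ I) x y       ≈⟨ ⊗-identityʳ L x y ⟩
    L x y             ∎

-- Rows with affine support and quadratic phase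

1+i : ℂ
1+i = 1# + i

-- The number (1 - i) / 2, given by constant sequences so that identities about it hold by
-- computation.
1+i⁻¹ : ℂ
1+i⁻¹ = mkℝ (λ _ → ½) (const-cauchy ½) +i mkℝ (λ _ → ℚ.- ½) (const-cauchy (ℚ.- ½))

1+i-inverse : 1+i * 1+i⁻¹ ≃ 1#
1+i-inverse = componentwise (pointwise λ _ → refl) (pointwise λ _ → refl)

2*∣1+i⁻¹∣²≃1 : 2# * (1+i⁻¹ * conj 1+i⁻¹) ≃ 1#
2*∣1+i⁻¹∣²≃1 = componentwise (pointwise λ _ → refl) (pointwise λ _ → refl)

sgn : Bool → ℂ
sgn b = if b then -ᶜ 1# else 1#

≃-ᶜ⇒≃0 : ∀ {z} → z ≃ -ᶜ z → z ≃ 0#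
≃-ᶜ⇒≃0 {z} e = begin
  z                 ≈⟨ *-identityˡ z ⟨
  1# * z            ≈⟨ *-cong (≃.trans (*-comm half 2#) 2*∣1+i⁻¹∣²≃1) (≃.refl {z}) ⟨
  (half * 2#) * z   ≈⟨ *-assoc half 2# z ⟩
  half * (2# * z)   ≈⟨ *-cong (≃.refl {half}) (+-double z) ⟨
  half * (z + z)    ≈⟨ *-cong (≃.refl {half}) (+-cong (≃.refl {z}) e) ⟩
  half * (z + -ᶜ z) ≈⟨ *-cong (≃.refl {half}) (-‿inverseʳ z) ⟩
  half * 0#         ≈⟨ zeroʳ half ⟩
  0#                ∎
  where
  half : ℂ
  -- The squared modulus of (1 + i)⁻¹ is 1/2, so it serves as the inverse of 2.
  half = 1+i⁻¹ * conj 1+i⁻¹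

-ᶜ-∑ : ∀ {n} (f : Bits n → ℂ) → ∑ (λ x → -ᶜ f x) ≃ -ᶜ ∑ f
-ᶜ-∑ f = ≃.trans (∑-cong λ x → ≃.sym (-1*z≃-z (f x)))
  (≃.trans (≃.sym (*-∑ (-ᶜ 1#) f)) (-1*z≃-z (∑ f)))

conj-𝟙 : ∀ b → conj (𝟙 b) ≃ 𝟙 b
conj-𝟙 true  = componentwise (pointwise λ _ → refl) (pointwise λ _ → refl)
conj-𝟙 false = componentwise (pointwise λ _ → refl) (pointwise λ _ → refl)

-- s is the support and K the common direction of its nonempty row fibres; σ is the
-- exponent of the sign by which a translation changes the ratio of two rows.
module Rows {n} (s : Bits n → Bits n → Bool) (K : Bits n → Bool)
  (φ : Bits n → Bits n → ℂ) (σ : Bits n → Bits n → Bits n → Bool)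
  (K-subspace : IsSubspace K)
  (s-coset : ∀ x y d → s x y ≡ true → s x (d ⊕ y) ≡ K d)
  (φ-unit : ∀ x y → φ x y * conj (φ x y) ≃ 1#)
  (φ-twist : ∀ x x′ y d →
    φ x (d ⊕ y) * conj (φ x′ (d ⊕ y)) ≃ sgn (σ x x′ d) * (φ x y * conj (φ x′ y)))
  where

  open IsSubspace K-subspace

  g : Matrix n
  g x y = 𝟙 (s x y) * φ x y

  gram : Matrix n
  gram = g ⊗ (g †)

  -- Over 𝔽₂ the difference z - y is z + y, and z is y translated by it; so a nonempty fibre is the
  -- coset y + K of any of its points.
  s≡K : ∀ x y z → s x y ≡ true → s x z ≡ K (z ⊕ y)
  s≡K x y z s≡t = trans (cong (s x) (sym (⊕-cancelʳ z y))) (s-coset x y (z ⊕ y) s≡t)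

  s-invariant : ∀ x y d z → s x y ≡ true → K d ≡ true → s x (d ⊕ z) ≡ s x z
  s-invariant x y d z s≡t d∈K =
    trans (s≡K x y (d ⊕ z) s≡t)
      (trans (cong K (⊕-assoc d z y))
        (trans (translate d (z ⊕ y) d∈K) (sym (s≡K x y z s≡t))))

  g-conj : ∀ x x′ z → g x z * conj (g x′ z) ≃
           (𝟙 (s x z) * 𝟙 (s x′ z)) * (φ x z * conj (φ x′ z))
  g-conj x x′ z = begin
    g x z * conj (g x′ z)
      ≈⟨ *-cong (≃.refl {g x z}) (conj-* (𝟙 (s x′ z)) (φ x′ z)) ⟩
    g x z * (conj (𝟙 (s x′ z)) * conj (φ x′ z))
      ≈⟨ *-cong (≃.refl {g x z}) (*-cong (conj-𝟙 (s x′ z)) (≃.refl {conj (φ x′ z)})) ⟩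
    g x z * (𝟙 (s x′ z) * conj (φ x′ z))
      ≈⟨ *-interchange (𝟙 (s x z)) (φ x z) (𝟙 (s x′ z)) (conj (φ x′ z)) ⟩
    (𝟙 (s x z) * 𝟙 (s x′ z)) * (φ x z * conj (φ x′ z)) ∎

  𝟙-idem : ∀ b → 𝟙 b * 𝟙 b ≃ 𝟙 b
  𝟙-idem true  = *-identityˡ 1#
  𝟙-idem false = zeroˡ 0#

  -- Each term on the support is a squared modulus equal to 1, so the sum counts the fibre of row
  -- `x`; translation by its point `y` turns the fibre into `K`.
  gram-diagonal : ∀ x y → s x y ≡ true → gram x x ≃ ∑ (λ z → 𝟙 (K z))
  gram-diagonal x y s≡t = begin
    ∑ (λ z → g x z * conj (g x z))
      ≈⟨ ∑-cong (λ z → ≃.trans (g-conj x x z)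
           (≃.trans (*-cong (𝟙-idem (s x z)) (φ-unit x z)) (*-identityʳ (𝟙 (s x z))))) ⟩
    ∑ (λ z → 𝟙 (s x z))
      ≈⟨ ∑-translate y (λ z → 𝟙 (s x z)) ⟨
    ∑ (λ z → 𝟙 (s x (y ⊕ z)))
      ≈⟨ ∑-cong (λ z → ≃.reflexive (cong 𝟙
           (trans (cong (s x) (⊕-comm y z)) (s-coset x y z s≡t)))) ⟩
    ∑ (λ z → 𝟙 (K z)) ∎

  gram-disjoint : ∀ x x′ → (∀ z → s x z ∧ s x′ z ≡ false) → gram x x′ ≃ 0#
  gram-disjoint x x′ disjoint = ≃.trans (∑-cong term) (∑-0 n)
    where
    𝟙-∧ : ∀ b c → b ∧ c ≡ false → 𝟙 b * 𝟙 c ≃ 0#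
    𝟙-∧ false c     _ = zeroˡ (𝟙 c)
    𝟙-∧ true  false _ = zeroʳ 1#
    term : ∀ z → g x z * conj (g x′ z) ≃ 0#
    term z = ≃.trans (g-conj x x′ z)
      (≃.trans (*-cong (𝟙-∧ (s x z) (s x′ z) (disjoint z)) (≃.refl {φ x z * conj (φ x′ z)}))
        (zeroˡ (φ x z * conj (φ x′ z))))

  -- Translation by `d` permutes the terms. It preserves both supports because d ∈ K, and negates
  -- every term because the sign at `d` is -1.
  gram-cancel : ∀ x x′ y d → s x y ≡ true → s x′ y ≡ true → K d ≡ true → σ x x′ d ≡ true →
    gram x x′ ≃ 0#
  gram-cancel x x′ y d s≡t s′≡t d∈K σ≡t = ≃-ᶜ⇒≃0 (begin
    ∑ p                    ≈⟨ ∑-translate d p ⟨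
    ∑ (λ z → p (d ⊕ z))    ≈⟨ ∑-cong flip ⟩
    ∑ (λ z → -ᶜ p z)       ≈⟨ -ᶜ-∑ p ⟩
    -ᶜ ∑ p                 ∎)
    where
    p : Bits n → ℂ
    p z = g x z * conj (g x′ z)
    flip : ∀ z → p (d ⊕ z) ≃ -ᶜ p z
    flip z = begin
      p (d ⊕ z)
        ≈⟨ g-conj x x′ (d ⊕ z) ⟩
      (𝟙 (s x (d ⊕ z)) * 𝟙 (s x′ (d ⊕ z))) * (φ x (d ⊕ z) * conj (φ x′ (d ⊕ z)))
        ≈⟨ *-cong (≃.reflexive (cong₂ (λ b c → 𝟙 b * 𝟙 c)
             (s-invariant x y d z s≡t d∈K) (s-invariant x′ y d z s′≡t d∈K)))
             (≃.trans (φ-twist x x′ z d) (*-cong (≃.reflexive (cong sgn σ≡t)) (≃.refl {D}))) ⟩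
      S * (-ᶜ 1# * D)   ≈⟨ *-assoc S (-ᶜ 1#) D ⟨
      (S * -ᶜ 1#) * D   ≈⟨ *-cong (*-comm S (-ᶜ 1#)) (≃.refl {D}) ⟩
      (-ᶜ 1# * S) * D   ≈⟨ *-assoc (-ᶜ 1#) S D ⟩
      -ᶜ 1# * (S * D)   ≈⟨ -1*z≃-z (S * D) ⟩
      -ᶜ (S * D)        ≈⟨ -ᶜ-cong (g-conj x x′ z) ⟨
      -ᶜ p z            ∎
      where
      S D : ℂ
      S = 𝟙 (s x z) * 𝟙 (s x′ z)
      D = φ x z * conj (φ x′ z)

  Proportional : Bits n → Bits n → Set
  Proportional x x′ = ∃[ p ] (∀ z → g x z ≃ p * g x′ z)

  -- Fibres that share `y` are the same coset y + K. Every sign on `K` is +1, so the ratio of the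
  -- two phases is constant along this coset.
  proportional : ∀ x x′ y → s x y ≡ true → s x′ y ≡ true →
    (∀ d → K d ∧ σ x x′ d ≡ false) → Proportional x x′
  proportional x x′ y s≡t s′≡t trivial = p , row
    where
    p : ℂ
    -- The ratio at the common point `y`: the conjugate of a phase of modulus one is its inverse.
    p = φ x y * conj (φ x′ y)
    σ-false : ∀ {b c} → b ≡ true → b ∧ c ≡ false → c ≡ false
    σ-false refl e = e
    phase-ratio : ∀ z → s x′ z ≡ true → φ x z ≃ p * φ x′ z
    phase-ratio z s′z = begin
      φ x z
        ≈⟨ *-identityʳ (φ x z) ⟨
      φ x z * 1#
        ≈⟨ *-cong (≃.refl {φ x z})
             (≃.trans (*-comm (conj (φ x′ z)) (φ x′ z)) (φ-unit x′ z)) ⟨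
      φ x z * (conj (φ x′ z) * φ x′ z)
        ≈⟨ *-assoc (φ x z) (conj (φ x′ z)) (φ x′ z) ⟨
      D z * φ x′ z
        ≈⟨ *-cong (≃.reflexive (cong D (sym (⊕-cancelʳ z y)))) (≃.refl {φ x′ z}) ⟩
      D ((z ⊕ y) ⊕ y) * φ x′ z
        ≈⟨ *-cong (φ-twist x x′ y (z ⊕ y)) (≃.refl {φ x′ z}) ⟩
      (sgn (σ x x′ (z ⊕ y)) * p) * φ x′ z
        ≈⟨ *-cong (*-cong (≃.reflexive (cong sgn σ≡f)) (≃.refl {p})) (≃.refl {φ x′ z}) ⟩
      (1# * p) * φ x′ z
        ≈⟨ *-cong (*-identityˡ p) (≃.refl {φ x′ z}) ⟩
      p * φ x′ z ∎
      where
      D : Bits n → ℂ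
      D z = φ x z * conj (φ x′ z)
      σ≡f : σ x x′ (z ⊕ y) ≡ false
      σ≡f = σ-false (trans (sym (s≡K x′ y z s′≡t)) s′z) (trivial (z ⊕ y))
    scaled : ∀ b b′ z → b ≡ b′ → (b′ ≡ true → φ x z ≃ p * φ x′ z) →
      𝟙 b * φ x z ≃ p * (𝟙 b′ * φ x′ z)
    scaled false .false z refl _ = begin
      0# * φ x z        ≈⟨ zeroˡ (φ x z) ⟩
      0#                ≈⟨ zeroʳ p ⟨
      p * 0#            ≈⟨ *-cong (≃.refl {p}) (zeroˡ (φ x′ z)) ⟨
      p * (0# * φ x′ z) ∎
    scaled true  .true  z refl e = begin
      1# * φ x z        ≈⟨ *-identityˡ (φ x z) ⟩
      φ x z             ≈⟨ e refl ⟩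
      p * φ x′ z        ≈⟨ *-cong (≃.refl {p}) (*-identityˡ (φ x′ z)) ⟨
      p * (1# * φ x′ z) ∎
    row : ∀ z → g x z ≃ p * g x′ z
    row z = scaled (s x z) (s x′ z) z
      (trans (s≡K x y z s≡t) (sym (s≡K x′ y z s′≡t))) (phase-ratio z)

  -- Two searches settle the case: one for a common point of the supports, then one for a direction
  -- in `K` with sign -1.
  orthogonal-or-proportional : ∀ x x′ → gram x x′ ≃ 0# ⊎ Proportional x x′
  orthogonal-or-proportional x x′ =
    [ (λ (y , both) → meeting y (Bool.∧-conicalˡ _ _ both) (Bool.∧-conicalʳ _ _ both))
    , (λ disjoint → inj₁ (gram-disjoint x x′ disjoint))
    ]′ (search (λ z → s x z ∧ s x′ z))
    where
    meeting : ∀ y → s x y ≡ true → s x′ y ≡ true → gram x x′ ≃ 0# ⊎ Proportional x x′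
    meeting y s≡t s′≡t =
      [ (λ (d , twisted) → inj₁ (gram-cancel x x′ y d s≡t s′≡t
          (Bool.∧-conicalˡ _ _ twisted) (Bool.∧-conicalʳ _ _ twisted)))
      , (λ trivial → inj₂ (proportional x x′ y s≡t s′≡t trivial))
      ]′ (search (λ d → K d ∧ σ x x′ d))

-- Affine functions

∷ʳ-⊕ : ∀ {n} (x y : Bits n) a b → (x ∷ʳ a) ⊕ (y ∷ʳ b) ≡ (x ⊕ y) ∷ʳ (a xor b)
∷ʳ-⊕ []      []      a b = refl
∷ʳ-⊕ (c ∷ x) (d ∷ y) a b = cong ((c xor d) ∷_) (∷ʳ-⊕ x y a b)

reverse-⊕ : ∀ {n} (x y : Bits n) → reverse x ⊕ reverse y ≡ reverse (x ⊕ y)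
reverse-⊕ []      []      = refl
reverse-⊕ (c ∷ x) (d ∷ y)
  rewrite reverse-∷ c x | reverse-∷ d y | reverse-∷ (c xor d) (x ⊕ y)
  = trans (∷ʳ-⊕ (reverse x) (reverse y) c d) (cong (_∷ʳ (c xor d)) (reverse-⊕ x y))

-- The last bit is the homogenising coordinate: `true` for points, `false` for differences of
-- points. Reversing `y` matches the column order of the signature matrix.
coord : ∀ {n} → Bits n → Bits n → Bool → Bits (suc (n ℕ.+ n))
coord x y b = (x ++ reverse y) ∷ʳ b

coord-⊕ : ∀ {n} (x x′ y y′ : Bits n) b b′ →
  coord x y b ⊕ coord x′ y′ b′ ≡ coord (x ⊕ x′) (y ⊕ y′) (b xor b′)
coord-⊕ x x′ y y′ b b′ = trans
  (∷ʳ-⊕ (x ++ reverse y) (x′ ++ reverse y′) b b′)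
  (cong (_∷ʳ (b xor b′)) (trans (zipWith-++ _xor_ x (reverse y) x′ (reverse y′))
    (cong ((x ⊕ x′) ++_) (reverse-⊕ y y′))))

xor-interchange : ∀ a b c d → (a xor b) xor (c xor d) ≡ (a xor c) xor (b xor d)
xor-interchange = interchange
  where
  open import Algebra.Properties.CommutativeSemigroup
    (CommutativeRing.+-commutativeSemigroup Bool.xor-∧-commutativeRing)

⟨⟩-⊕ : ∀ {n} (α x y : Bits n) → ⟨ α , x ⊕ y ⟩ ≡ ⟨ α , x ⟩ xor ⟨ α , y ⟩
⟨⟩-⊕ []      []      []      = refl
⟨⟩-⊕ (a ∷ α) (b ∷ x) (c ∷ y)
  rewrite ⟨⟩-⊕ α x y | Bool.∧-distribˡ-xor a b c =
  xor-interchange (a ∧ b) (a ∧ c) ⟨ α , x ⟩ ⟨ α , y ⟩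

eval : ∀ {k r} → Vec (Bits k) r → Bits k → Bits r
eval A x = map (λ a → ⟨ a , x ⟩) A

eval-⊕ : ∀ {k r} (A : Vec (Bits k) r) x y → eval A (x ⊕ y) ≡ eval A x ⊕ eval A y
eval-⊕ []      x y = refl
eval-⊕ (a ∷ A) x y = cong₂ _∷_ (⟨⟩-⊕ a x y) (eval-⊕ A x y)

isZero : ∀ {r} → Bits r → Bool
isZero x = does (≡-dec Bool._≟_ x 𝟎)

isZero⇒≡𝟎 : ∀ {r} (x : Bits r) → isZero x ≡ true → x ≡ 𝟎
isZero⇒≡𝟎 x e with ≡-dec Bool._≟_ x 𝟎
... | yes x≡𝟎 = x≡𝟎

isZero-𝟎 : ∀ {r} → isZero (𝟎 {r}) ≡ true
isZero-𝟎 {r} = dec-true (≡-dec Bool._≟_ 𝟎 (𝟎 {r})) refl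

^-+ : ∀ z a b → z ^ (a ℕ.+ b) ≃ z ^ a * z ^ b
^-+ z zero    b = ≃.sym (*-identityˡ (z ^ b))
^-+ z (suc a) b = ≃.trans (*-cong (≃.refl {z}) (^-+ z a b)) (≃.sym (*-assoc z (z ^ a) (z ^ b)))

^-* : ∀ z w k → (z * w) ^ k ≃ z ^ k * w ^ k
^-* z w zero    = ≃.sym (*-identityˡ 1#)
^-* z w (suc k) = ≃.trans (*-cong (≃.refl {z * w}) (^-* z w k)) (*-interchange z w (z ^ k) (w ^ k))

conj-^ : ∀ z k → conj (z ^ k) ≃ conj z ^ k
conj-^ z zero    = conj-𝟙 true
conj-^ z (suc k) = ≃.trans (conj-* z (z ^ k)) (*-cong (≃.refl {conj z}) (conj-^ z k))

^-cong : ∀ {z w} k → z ≃ w → z ^ k ≃ w ^ k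
^-cong zero    e = ≃.refl
^-cong (suc k) e = *-cong e (^-cong k e)

1^k≃1 : ∀ k → 1# ^ k ≃ 1#
1^k≃1 zero    = ≃.refl
1^k≃1 (suc k) = ≃.trans (*-identityˡ (1# ^ k)) (1^k≃1 k)

^-inverse : ∀ {z w} k → z * w ≃ 1# → z ^ k * w ^ k ≃ 1#
^-inverse {z} {w} k e = ≃.trans (≃.sym (^-* z w k)) (≃.trans (^-cong k e) (1^k≃1 k))

exponent : ∀ {k m} → Vec (Bits k) m → Bits k → ℕ
exponent αs v = sum (map (λ α → toInt ⟨ α , v ⟩) αs)

phase : ∀ {k m} → Vec (Bits k) m → Bits k → ℂ
phase αs v = i ^ exponent αs v

i^ : Bool → ℂ
i^ b = i ^ toInt b

phase-unit : ∀ {k m} (αs : Vec (Bits k) m) v → phase αs v * conj (phase αs v) ≃ 1#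
phase-unit αs v = ≃.trans (*-cong (≃.refl {phase αs v}) (conj-^ i (exponent αs v)))
  (^-inverse (exponent αs v) (componentwise (pointwise λ _ → refl) (pointwise λ _ → refl)))

-- The symmetric 𝔽₂-bilinear form B that polarises the exponent Q: modulo 4, Q(d + e) = Q(d) + Q(e)
-- - 2 B(d, e), because a xor b = a + b - 2ab for bits.
twist : ∀ {k m} → Vec (Bits k) m → Bits k → Bits k → Bool
twist []       d e = false
twist (α ∷ αs) d e = (⟨ α , d ⟩ ∧ ⟨ α , e ⟩) xor twist αs d e

-- The case of a single form L, with a = L(v), b = L(e), c = L(d). The sign is independent of `a`,
-- which is why the twist does not depend on the base point.
i^-twist : ∀ a b c →
  i^ (b xor a) * conj (i^ (b xor (c xor a))) ≃ sgn (c ∧ b) * (i^ a * conj (i^ (c xor a)))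
i^-twist false false false = componentwise (pointwise λ _ → refl) (pointwise λ _ → refl)
i^-twist false false true  = componentwise (pointwise λ _ → refl) (pointwise λ _ → refl)
i^-twist false true  false = componentwise (pointwise λ _ → refl) (pointwise λ _ → refl)
i^-twist false true  true  = componentwise (pointwise λ _ → refl) (pointwise λ _ → refl)
i^-twist true  false false = componentwise (pointwise λ _ → refl) (pointwise λ _ → refl)
i^-twist true  false true  = componentwise (pointwise λ _ → refl) (pointwise λ _ → refl)
i^-twist true  true  false = componentwise (pointwise λ _ → refl) (pointwise λ _ → refl)
i^-twist true  true  true  = componentwise (pointwise λ _ → refl) (pointwise λ _ → refl)

sgn-xor : ∀ a b → sgn (a xor b) ≃ sgn a * sgn b
sgn-xor false b     = ≃.sym (*-identityˡ (sgn b))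
sgn-xor true  false = componentwise (pointwise λ _ → refl) (pointwise λ _ → refl)
sgn-xor true  true  = componentwise (pointwise λ _ → refl) (pointwise λ _ → refl)

cross : ∀ {k m} → Vec (Bits k) m → Bits k → Bits k → ℂ
cross αs v w = phase αs v * conj (phase αs w)

cross-∷ : ∀ {k m} α (αs : Vec (Bits k) m) v w →
  cross (α ∷ αs) v w ≃ (i^ ⟨ α , v ⟩ * conj (i^ ⟨ α , w ⟩)) * cross αs v w
cross-∷ α αs v w = begin
  phase (α ∷ αs) v * conj (phase (α ∷ αs) w)
    ≈⟨ *-cong (split v) (≃.trans (conj-cong (split w)) (conj-* (i^ ⟨ α , w ⟩) (phase αs w))) ⟩
  (i^ ⟨ α , v ⟩ * phase αs v) * (conj (i^ ⟨ α , w ⟩) * conj (phase αs w))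
    ≈⟨ *-interchange (i^ ⟨ α , v ⟩) (phase αs v) (conj (i^ ⟨ α , w ⟩)) (conj (phase αs w)) ⟩
  (i^ ⟨ α , v ⟩ * conj (i^ ⟨ α , w ⟩)) * cross αs v w ∎
  where
  split : ∀ v → phase (α ∷ αs) v ≃ i^ ⟨ α , v ⟩ * phase αs v
  split v = ^-+ i (toInt ⟨ α , v ⟩) (exponent αs v)

-- Each form L contributes i^L(v) · i^(−L(d + v)), and translating v by e multiplies
-- this by −1 exactly when L(d) = L(e) = 1.
cross-twist : ∀ {k m} (αs : Vec (Bits k) m) v d e →
  cross αs (e ⊕ v) (e ⊕ (d ⊕ v)) ≃ sgn (twist αs d e) * cross αs v (d ⊕ v)
cross-twist []       v d e = ≃.sym (*-identityˡ (1# * conj 1#))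
cross-twist (α ∷ αs) v d e = begin
  cross (α ∷ αs) (e ⊕ v) (e ⊕ (d ⊕ v))
    ≈⟨ cross-∷ α αs (e ⊕ v) (e ⊕ (d ⊕ v)) ⟩
  (i^ ⟨ α , e ⊕ v ⟩ * conj (i^ ⟨ α , e ⊕ (d ⊕ v) ⟩)) * cross αs (e ⊕ v) (e ⊕ (d ⊕ v))
    ≈⟨ *-cong head (cross-twist αs v d e) ⟩
  (sgn (c ∧ b) * q) * (sgn (twist αs d e) * cross αs v (d ⊕ v))
    ≈⟨ *-interchange (sgn (c ∧ b)) q (sgn (twist αs d e)) (cross αs v (d ⊕ v)) ⟩
  (sgn (c ∧ b) * sgn (twist αs d e)) * (q * cross αs v (d ⊕ v))
    ≈⟨ *-cong (sgn-xor (c ∧ b) (twist αs d e)) (cross-∷ α αs v (d ⊕ v)) ⟨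
  sgn (twist (α ∷ αs) d e) * cross (α ∷ αs) v (d ⊕ v) ∎
  where
  a b c : Bool
  a = ⟨ α , v ⟩
  b = ⟨ α , e ⟩
  c = ⟨ α , d ⟩
  q : ℂ
  q = i^ a * conj (i^ ⟨ α , d ⊕ v ⟩)
  head : i^ ⟨ α , e ⊕ v ⟩ * conj (i^ ⟨ α , e ⊕ (d ⊕ v) ⟩) ≃ sgn (c ∧ b) * q
  head = ≃.trans
    (≃.reflexive (cong₂ (λ p q → i^ p * conj (i^ q)) (⟨⟩-⊕ α e v)
      (trans (⟨⟩-⊕ α e (d ⊕ v)) (cong (b xor_) (⟨⟩-⊕ α d v)))))
    (≃.trans (i^-twist a b c)
      (≃.reflexive (cong (λ p → sgn (c ∧ b) * (i^ a * conj (i^ p))) (sym (⟨⟩-⊕ α d v)))))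

-- Signature matrices of affine functions

module AffineMatrix {n r m}
  (A : Vec (Bits (suc (n ℕ.+ n))) r) (αs : Vec (Bits (suc (n ℕ.+ n))) m) where

  point : Bits n → Bits n → Bits (suc (n ℕ.+ n))
  point x y = coord x y true

  direction : Bits n → Bits (suc (n ℕ.+ n))
  direction d = coord 𝟎 d false

  point-⊕ : ∀ x y d → point x (d ⊕ y) ≡ direction d ⊕ point x y
  point-⊕ x y d = sym (trans (coord-⊕ 𝟎 x d y false true)
    (cong (λ v → coord v (d ⊕ y) true) (⊕-identityˡ x)))

  difference : Bits n → Bits n → Bits (suc (n ℕ.+ n))
  difference x x′ = coord (x′ ⊕ x) 𝟎 false

  point-difference : ∀ x x′ y → point x′ y ≡ difference x x′ ⊕ point x y
  point-difference x x′ y = sym (trans (coord-⊕ (x′ ⊕ x) x 𝟎 y false true)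
    (cong₂ (λ u v → coord u v true) (⊕-cancelʳ x′ x) (⊕-identityˡ y)))

  -- `s` and `φ` copy the two factors of `affineFun`, so `lam · g` is definitionally the signature
  -- matrix of `affineFun lam A αs`.
  s : Bits n → Bits n → Bool
  s x y = isZero (eval A (point x y))

  -- The last bit of `direction d` is `false`, which kills the constant terms of the equations: this
  -- is the solution space of the homogeneous system in the column variables, the same for every
  -- row.
  K : Bits n → Bool
  K d = isZero (eval A (direction d))

  φ : Bits n → Bits n → ℂ
  φ x y = phase αs (point x y)

  -- Changing the row translates by `difference x x′` and changing the column by `direction d`; the
  -- sign is the bilinear form of the two translations.
  σ : Bits n → Bits n → Bits n → Bool
  σ x x′ d = twist αs (difference x x′) (direction d)

  eval-direction-⊕ : ∀ d e →
    eval A (direction (d ⊕ e)) ≡ eval A (direction d) ⊕ eval A (direction e)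
  eval-direction-⊕ d e = trans
    (cong (eval A) (sym (trans (coord-⊕ 𝟎 𝟎 d e false false)
      (cong (λ u → coord u (d ⊕ e) false) (⊕-identityˡ 𝟎)))))
    (eval-⊕ A (direction d) (direction e))

  eval-direction-𝟎 : eval A (direction 𝟎) ≡ 𝟎
  eval-direction-𝟎 = trans (cong (λ u → eval A (direction u)) (sym (⊕-same 𝟎)))
    (trans (eval-direction-⊕ 𝟎 𝟎) (⊕-same (eval A (direction 𝟎))))

  K-subspace : IsSubspace K
  K-subspace = record
    { contains-𝟎 = trans (cong isZero eval-direction-𝟎) (isZero-𝟎 {r})
    ; translate = λ d e d∈K → cong isZero (trans (eval-direction-⊕ d e)
        (trans (cong (_⊕ eval A (direction e)) (isZero⇒≡𝟎 (eval A (direction d)) d∈K))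
          (⊕-identityˡ (eval A (direction e)))))
    }

  s-coset : ∀ x y d → s x y ≡ true → s x (d ⊕ y) ≡ K d
  s-coset x y d s≡t = cong isZero (trans (cong (eval A) (point-⊕ x y d))
    (trans (eval-⊕ A (direction d) (point x y))
      (trans (cong (eval A (direction d) ⊕_) (isZero⇒≡𝟎 (eval A (point x y)) s≡t))
        (⊕-identityʳ (eval A (direction d))))))

  φ-twist : ∀ x x′ y d →
    φ x (d ⊕ y) * conj (φ x′ (d ⊕ y)) ≃ sgn (σ x x′ d) * (φ x y * conj (φ x′ y))
  φ-twist x x′ y d = ≃.trans
    (≃.reflexive (cong₂ (cross αs) (point-⊕ x y d)
      (trans (point-⊕ x′ y d) (cong (direction d ⊕_) (point-difference x x′ y)))))
    (≃.trans (cross-twist αs (point x y) (difference x x′) (direction d))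
      (≃.reflexive (cong (λ v → sgn (σ x x′ d) * cross αs (point x y) v)
        (sym (point-difference x x′ y)))))

  open Rows s K φ σ K-subspace s-coset (λ x y → phase-unit αs (point x y)) φ-twist public

-- Invertibility and the Gram matrix

⊗-row : ∀ {n} (M N : Matrix n) p x x′ → (∀ z → M x z ≃ p * M x′ z) →
  ∀ y → (M ⊗ N) x y ≃ p * (M ⊗ N) x′ y
⊗-row M N p x x′ e y =
  ≃.trans (∑-cong λ z → *-cong (e z) (≃.refl {N z y})) (·-⊗ p M N x′ y)

I-off-diagonal : ∀ {n} {x y : Bits n} → x ≢ y → I x y ≡ 0#
I-off-diagonal {x = x} {y} x≢y with ≡-dec Bool._≟_ x y
... | yes x≡y = ⊥-elim (x≢y x≡y)
... | no  _   = refl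

-- The right inverse carries a relation between rows of `M` over to rows of `I`, where column `x`
-- reads 1 = 0. This excludes both an empty row (p = 0, x′ = x) and two proportional rows (x′ ≠ x).
¬zero-multiple : ∀ {n} {M N : Matrix n} → M ⊗ N ≃ᵐ I → ∀ {p x x′} → p * I x′ x ≃ 0# →
  ¬ (∀ z → M x z ≃ p * M x′ z)
¬zero-multiple {M = M} {N} MN≃I {p} {x} {x′} p*I≃0 e = 1≄0 (begin
  1#                ≈⟨ ≃.reflexive (I-diagonal x) ⟨
  I x x             ≈⟨ MN≃I x x ⟨
  (M ⊗ N) x x       ≈⟨ ⊗-row M N p x x′ e x ⟩
  p * (M ⊗ N) x′ x  ≈⟨ *-cong (≃.refl {p}) (MN≃I x′ x) ⟩
  p * I x′ x        ≈⟨ p*I≃0 ⟩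
  0#                ∎)

module _ {n r m}
  (A : Vec (Bits (suc (n ℕ.+ n))) r) (αs : Vec (Bits (suc (n ℕ.+ n))) m) where
  open AffineMatrix {n} A αs

  gram-of-invertible : ∀ {R : Matrix n} → g ⊗ R ≃ᵐ I → ∃[ k ] gram ≃ᵐ (2# ^ k) · I
  gram-of-invertible {R} gR≃I = k , entry
    where
    k = proj₁ (∑-subspace K K-subspace)
    -- A zero row is 0 times itself, the form that `¬zero-multiple` refutes.
    empty-row : ∀ x → (∀ y → s x y ≡ false) → ∀ z → g x z ≃ 0# * g x z
    empty-row x none z = ≃.trans (*-cong (≃.reflexive (cong 𝟙 (none z))) (≃.refl {φ x z}))
      (≃.trans (zeroˡ (φ x z)) (≃.sym (zeroˡ (g x z))))
    nonempty : ∀ x → ∃[ y ] s x y ≡ true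
    nonempty x =
      [ (λ found → found)
      , (λ none → ⊥-elim (¬zero-multiple {M = g} {R} gR≃I {0#} {x} {x} (zeroˡ (I x x))
          (empty-row x none)))
      ]′ (search (s x))
    off-diagonal : ∀ x x′ → x ≢ x′ → gram x x′ ≃ 0#
    off-diagonal x x′ x≢x′ =
      [ (λ e → e)
      , (λ (p , e) → ⊥-elim (¬zero-multiple {M = g} {R} gR≃I {p} {x} {x′}
          (≃.trans (*-cong (≃.refl {p}) (≃.reflexive (I-off-diagonal λ x′≡x → x≢x′ (sym x′≡x))))
            (zeroʳ p)) e))
      ]′ (orthogonal-or-proportional x x′)
    diagonal : ∀ x → gram x x ≃ 2# ^ k
    diagonal x = ≃.trans (gram-diagonal x (proj₁ (nonempty x)) (proj₂ (nonempty x)))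
      (proj₂ (∑-subspace K K-subspace))
    entry : ∀ x x′ → gram x x′ ≃ 2# ^ k * I x x′
    entry x x′ = by-cases (≡-dec Bool._≟_ x x′)
      where
      by-cases : Dec (x ≡ x′) → gram x x′ ≃ 2# ^ k * I x x′
      by-cases (yes refl) = begin
        gram x x        ≈⟨ diagonal x ⟩
        2# ^ k          ≈⟨ *-identityʳ (2# ^ k) ⟨
        2# ^ k * 1#     ≈⟨ *-cong (≃.refl {2# ^ k}) (≃.reflexive (I-diagonal x)) ⟨
        2# ^ k * I x x  ∎
      by-cases (no x≢x′) = begin
        gram x x′       ≈⟨ off-diagonal x x′ x≢x′ ⟩
        0#              ≈⟨ zeroʳ (2# ^ k) ⟨
        2# ^ k * 0#     ≈⟨ *-cong (≃.refl {2# ^ k}) (≃.reflexive (I-off-diagonal x≢x′)) ⟨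
        2# ^ k * I x x′ ∎

-- Normalisation to a unitary matrix

∣1+i⁻¹∣²ᵏ*2ᵏ≃1 : ∀ k → 1+i⁻¹ ^ k * conj (1+i⁻¹ ^ k) * 2# ^ k ≃ 1#
∣1+i⁻¹∣²ᵏ*2ᵏ≃1 k = begin
  1+i⁻¹ ^ k * conj (1+i⁻¹ ^ k) * 2# ^ k
    ≈⟨ *-cong (*-cong (≃.refl {1+i⁻¹ ^ k}) (conj-^ 1+i⁻¹ k)) (≃.refl {2# ^ k}) ⟩
  1+i⁻¹ ^ k * conj 1+i⁻¹ ^ k * 2# ^ k
    ≈⟨ *-cong (^-* 1+i⁻¹ (conj 1+i⁻¹) k) (≃.refl {2# ^ k}) ⟨
  (1+i⁻¹ * conj 1+i⁻¹) ^ k * 2# ^ k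
    ≈⟨ ^-inverse k (≃.trans (*-comm (1+i⁻¹ * conj 1+i⁻¹) 2#) 2*∣1+i⁻¹∣²≃1) ⟩
  1# ∎

unitary : ∀ {n} (M L : Matrix n) → M ⊗ (M †) ≃ᵐ I → L ⊗ M ≃ᵐ I → U M
unitary M L MM†≃I LM≃I =
  (λ x y → unwrap (MM†≃I x y)) ,
  (λ x y → unwrap (right-inverse⇒left-inverse L M (M †) LM≃I MM†≃I x y))

U₁⊆ℂˣ : ∀ {c} → U₁ c → ℂˣ c
U₁⊆ℂˣ {c} c∈U₁ = conj c , unwrap (U₁⇒*-conj {c} c∈U₁)

U⇒GL : ∀ {n} {M : Matrix n} → U M → GL M
U⇒GL {M = M} M∈U = (M †) , M∈U

affine-affineFun : ∀ {k r m} lam (A : Vec (Bits (suc k)) r) (αs : Vec (Bits (suc k)) m) →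
  Affine (affineFun lam A αs)
affine-affineFun lam A αs =
  lam , _ , _ , A , αs , λ v → unwrap (≃.refl {affineFun lam A αs v})

module Normalise {n r m}
  (A : Vec (Bits (suc (n ℕ.+ n))) r) (αs : Vec (Bits (suc (n ℕ.+ n))) m)
  (M M⁻¹ : Matrix n) (lam : ℂ) (M≃ : M ≃ᵐ lam · AffineMatrix.g {n} A αs)
  (MM⁻¹≃I : M ⊗ M⁻¹ ≃ᵐ I) (M⁻¹M≃I : M⁻¹ ⊗ M ≃ᵐ I) where

  open AffineMatrix {n} A αs

  -- As M = lam g, moving the scalar across to M⁻¹ gives a two-sided inverse of `g`.
  L : Matrix n
  L = lam · M⁻¹

  lam*gM⁻¹≃I : ∀ x y → lam * (g ⊗ M⁻¹) x y ≃ I x y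
  lam*gM⁻¹≃I x y = begin
    lam * (g ⊗ M⁻¹) x y   ≈⟨ ·-⊗ lam g M⁻¹ x y ⟨
    ((lam · g) ⊗ M⁻¹) x y ≈⟨ ⊗-cong {M = M} {lam · g} {M⁻¹} {M⁻¹} M≃ (λ _ _ → ≃.refl) x y ⟨
    (M ⊗ M⁻¹) x y         ≈⟨ MM⁻¹≃I x y ⟩
    I x y                 ∎

  gL≃I : g ⊗ L ≃ᵐ I
  gL≃I x y = ≃.trans (⊗-· lam g M⁻¹ x y) (lam*gM⁻¹≃I x y)

  Lg≃I : L ⊗ g ≃ᵐ I
  Lg≃I x y = begin
    (L ⊗ g) x y           ≈⟨ ·-⊗ lam M⁻¹ g x y ⟩
    lam * (M⁻¹ ⊗ g) x y   ≈⟨ ⊗-· lam M⁻¹ g x y ⟨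
    (M⁻¹ ⊗ (lam · g)) x y ≈⟨ ⊗-cong {M = M⁻¹} {M⁻¹} {M} {lam · g} (λ _ _ → ≃.refl) M≃ x y ⟨
    (M⁻¹ ⊗ M) x y         ≈⟨ M⁻¹M≃I x y ⟩
    I x y                 ∎

  k : ℕ
  k = proj₁ (gram-of-invertible A αs {L} gL≃I)

  N : Matrix n
  N = 1+i⁻¹ ^ k · g

  NN†≃I : N ⊗ (N †) ≃ᵐ I
  NN†≃I x y = begin
    (N ⊗ (N †)) x y
      ≈⟨ ⊗-cong {M = N} {N} {N †} {conj (1+i⁻¹ ^ k) · (g †)} (λ _ _ → ≃.refl)
           (λ z w → conj-* (1+i⁻¹ ^ k) (g w z)) x y ⟩
    (N ⊗ (conj (1+i⁻¹ ^ k) · (g †))) x y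
      ≈⟨ ⊗-· (conj (1+i⁻¹ ^ k)) N (g †) x y ⟩
    conj (1+i⁻¹ ^ k) * (N ⊗ (g †)) x y
      ≈⟨ *-cong (≃.refl {conj (1+i⁻¹ ^ k)}) (·-⊗ (1+i⁻¹ ^ k) g (g †) x y) ⟩
    conj (1+i⁻¹ ^ k) * (1+i⁻¹ ^ k * gram x y)
      ≈⟨ *-cong (≃.refl {conj (1+i⁻¹ ^ k)}) (*-cong (≃.refl {1+i⁻¹ ^ k})
           (proj₂ (gram-of-invertible A αs {L} gL≃I) x y)) ⟩
    conj (1+i⁻¹ ^ k) * (1+i⁻¹ ^ k * (2# ^ k * I x y))
      ≈⟨ x∙yz≈yx∙z (conj (1+i⁻¹ ^ k)) (1+i⁻¹ ^ k) (2# ^ k * I x y) ⟩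
    1+i⁻¹ ^ k * conj (1+i⁻¹ ^ k) * (2# ^ k * I x y)
      ≈⟨ *-assoc (1+i⁻¹ ^ k * conj (1+i⁻¹ ^ k)) (2# ^ k) (I x y) ⟨
    1+i⁻¹ ^ k * conj (1+i⁻¹ ^ k) * 2# ^ k * I x y
      ≈⟨ *-cong (∣1+i⁻¹∣²ᵏ*2ᵏ≃1 k) (≃.refl {I x y}) ⟩
    1# * I x y
      ≈⟨ *-identityˡ (I x y) ⟩
    I x y ∎

  -- The factor (1 + i)ᵏ compensates the normalisation of `N`, giving the left inverse from which N†
  -- N = I follows.
  scaledL : Matrix n
  scaledL = 1+i ^ k · L

  LN≃I : scaledL ⊗ N ≃ᵐ I
  LN≃I x y = begin
    (scaledL ⊗ N) x y                   ≈⟨ ·-⊗ (1+i ^ k) L N x y ⟩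
    1+i ^ k * (L ⊗ N) x y               ≈⟨ *-cong (≃.refl {1+i ^ k}) (⊗-· (1+i⁻¹ ^ k) L g x y) ⟩
    1+i ^ k * (1+i⁻¹ ^ k * (L ⊗ g) x y) ≈⟨ *-assoc (1+i ^ k) (1+i⁻¹ ^ k) ((L ⊗ g) x y) ⟨
    1+i ^ k * 1+i⁻¹ ^ k * (L ⊗ g) x y   ≈⟨ *-cong (^-inverse k 1+i-inverse) (Lg≃I x y) ⟩
    1# * I x y                          ≈⟨ *-identityˡ (I x y) ⟩
    I x y                               ∎

  -- The entry of lam (g M⁻¹) = I at (𝟎, 𝟎) equals 1, so the matching entry of g M⁻¹ inverts `lam`.
  -- The scalar `c` undoes the normalisation: M = lam g = lam (1 + i)ᵏ N.
  lam⁻¹ c : ℂ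
  lam⁻¹ = (g ⊗ M⁻¹) 𝟎 𝟎
  c = lam * 1+i ^ k

  c∈ℂˣ : ℂˣ c
  c∈ℂˣ = lam⁻¹ * 1+i⁻¹ ^ k , unwrap (begin
    lam * 1+i ^ k * (lam⁻¹ * 1+i⁻¹ ^ k) ≈⟨ *-interchange lam (1+i ^ k) lam⁻¹ (1+i⁻¹ ^ k) ⟩
    lam * lam⁻¹ * (1+i ^ k * 1+i⁻¹ ^ k) ≈⟨ *-cong (lam*gM⁻¹≃I 𝟎 𝟎) (^-inverse k 1+i-inverse) ⟩
    I {n} 𝟎 𝟎 * 1#                      ≈⟨ *-identityʳ (I {n} 𝟎 𝟎) ⟩
    I {n} 𝟎 𝟎                           ≈⟨ ≃.reflexive (I-diagonal {n} 𝟎) ⟩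
    1#                                  ∎)

  M≃cN : M ≃ᵐ c · N
  M≃cN x y = begin
    M x y
      ≈⟨ M≃ x y ⟩
    lam * g x y
      ≈⟨ *-cong (*-identityʳ lam) (≃.refl {g x y}) ⟨
    lam * 1# * g x y
      ≈⟨ *-cong (*-cong (≃.refl {lam}) (^-inverse k 1+i-inverse)) (≃.refl {g x y}) ⟨
    lam * (1+i ^ k * 1+i⁻¹ ^ k) * g x y
      ≈⟨ *-cong (*-assoc lam (1+i ^ k) (1+i⁻¹ ^ k)) (≃.refl {g x y}) ⟨
    c * 1+i⁻¹ ^ k * g x y
      ≈⟨ *-assoc c (1+i⁻¹ ^ k) (g x y) ⟩
    c * (1+i⁻¹ ^ k * g x y) ∎

-- Comparison of the two quotients

𝒢𝒜⊆𝒰𝒜 : ∀ n → 𝒢𝒜 n ⊆ 𝒰𝒜 n mod ℂˣ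
𝒢𝒜⊆𝒰𝒜 n M ((M⁻¹ , MM⁻¹≈I , M⁻¹M≈I) , f , (lam , r , m , A , αs , f≈) , M≈f) =
  N ,
  (unitary N scaledL NN†≃I LN≃I ,
    -- Only the scalar factor has changed, so `N` is affine with the same `A` and `αs`.
    affineFun (1+i⁻¹ ^ k) A αs , affine-affineFun (1+i⁻¹ ^ k) A αs ,
    λ x y → unwrap (≃.refl {N x y})) ,
  c , c∈ℂˣ , λ x y → unwrap (M≃cN x y)
  where
  open Normalise {n} A αs M M⁻¹ lam
    (λ x y → ≃.trans {j = f (x ++ reverse y)} (wrap (M≈f x y)) (wrap (f≈ (x ++ reverse y))))
    (λ x y → wrap (MM⁻¹≈I x y)) (λ x y → wrap (M⁻¹M≈I x y))

𝒰𝒜⊆𝒢𝒜 : ∀ n → 𝒰𝒜 n ⊆ 𝒢𝒜 n mod U₁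
𝒰𝒜⊆𝒢𝒜 n M (M∈U , M∈𝒜) = M , (U⇒GL {M = M} M∈U , M∈𝒜) ,
  1# , *-conj⇒U₁ {1#} (componentwise (pointwise λ _ → refl) (pointwise λ _ → refl)) ,
  λ x y → unwrap (≃.sym (*-identityˡ (M x y)))

-- I = M M† = c c̄ N N† = |c|² I. The entry at (𝟎, 𝟎), present for every `n`, gives |c|² = 1.
unitary-factor : ∀ {n} {M N : Matrix n} → U M → U N → ∀ {c} → M ≋ c · N → U₁ c
unitary-factor {n} {M} {N} (MM†≈I , _) (NN†≈I , _) {c} M≈cN = *-conj⇒U₁ {c} (begin
  c * conj c                                 ≈⟨ *-identityʳ (c * conj c) ⟨
  c * conj c * 1#                            ≈⟨ *-cong (≃.refl {c * conj c}) (unit N NN†≈I) ⟨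
  c * conj c * (N ⊗ (N †)) 𝟎 𝟎               ≈⟨ *-assoc c (conj c) ((N ⊗ (N †)) 𝟎 𝟎) ⟩
  c * (conj c * (N ⊗ (N †)) 𝟎 𝟎)             ≈⟨ *-cong (≃.refl {c}) (⊗-· (conj c) N (N †) 𝟎 𝟎) ⟨
  c * (N ⊗ (conj c · (N †))) 𝟎 𝟎             ≈⟨ ·-⊗ c N (conj c · (N †)) 𝟎 𝟎 ⟨
  ((c · N) ⊗ (conj c · (N †))) 𝟎 𝟎
    ≈⟨ ⊗-cong {M = M} {c · N} {M †} {conj c · (N †)} (λ x y → wrap (M≈cN x y))
         (λ x y → ≃.trans (conj-cong (wrap (M≈cN y x))) (conj-* c (N y x))) 𝟎 𝟎 ⟨
  (M ⊗ (M †)) 𝟎 𝟎                            ≈⟨ unit M MM†≈I ⟩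
  1#                                         ∎)
  where
  unit : ∀ (M : Matrix n) → M ⊗ (M †) ≋ I → (M ⊗ (M †)) 𝟎 𝟎 ≃ 1#
  unit M e = ≃.trans (wrap (e 𝟎 𝟎)) (≃.reflexive (I-diagonal {n} 𝟎))

corollary4p2 : (n : ℕ) → 𝒢𝒜 n / ℂˣ ≐ 𝒰𝒜 n / U₁
corollary4p2 n = 𝒢𝒜⊆𝒰𝒜 n , 𝒰𝒜⊆𝒢𝒜 n , λ { M N (M∈U , _) (N∈U , _) → mk⇔
  -- The same scalar serves for both relations: between unitary matrices it must have norm one, so
  -- no two classes merge.
  (λ { (c , _ , M≈cN) → c , unitary-factor {n} {M} {N} M∈U N∈U {c} M≈cN , M≈cN })
  (λ { (c , c∈U₁ , M≈cN) → c , U₁⊆ℂˣ {c} c∈U₁ , M≈cN }) }
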